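{- Let $\alpha>0$ and $n\ge1$. In the adversarial-order secretary problem with an $\alpha$-power signal (defined in the context), the policy $\mathcal{A}(S)$ is optimal among deterministic policies, with worst-case success probability $$\mathrm{OPT}^{\mathrm{det}}_n(\alpha)=1-\left(1-\frac1n\right)^\alpha.$$
   Context: Notation: $[n]=\{1,\dots,n\}$. Adversarial-order secretary problem with an $\alpha$-power signal ($\alpha>0$ real): an adversary fixes an instance, i.e. a value vector $v\in\mathbb{N}_0^n$ with a unique maximum entry, located at a time $i^\star\in[n]$. Items arrive one by one at times $1,\dots,n$ in this order. A signal time $S\in[i^\star]$ is drawn with $$\Pr[S=s]=\frac{s^\alpha-(s-1)^\alpha}{(i^\star)^\alpha},\qquad s\in[i^\star].$$ At each time $t$ the policy observes $v_t$ and whether the content-free signal occurs at time $t$ ($S=t$); it then irrevocably decides whether to stop at time $t$. The policy knows $n$ and $\alpha$, but not the instance. It succeeds if it stops exactly at time $i^\star$. A deterministic policy uses no internal randomness: its decision at time $t$ is a function of the observations up to time $t$. The worst-case success probability of a policy is the infimum over all instances of length $n$ of its success probability (over the signal); $\mathrm{OPT}^{\mathrm{det}}_n(\alpha)$ is the supremum of the worst-case success probability over all deterministic policies, and a deterministic policy is optimal if it attains it. A time is a record if the item arriving then is the best item so far. The policy $\mathcal{A}(S)$ rejects all items before the signal time $S$ and then accepts the first record from time $S$ onward (including time $S$). -}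

module Defs where

open import Data.Bool using (Bool; T; T?; if_then_else_)
open import Data.Fin as Fin using (Fin; Fin′; toℕ; inject!)
import Data.Fin.Properties as Finₚ
open import Data.Integer as ℤ using (+_; +[1+_])
import Data.Integer.Properties as ℤₚ
open import Data.Nat as ℕ using (ℕ; zero; suc)
import Data.Nat.Properties as ℕₚ
import Data.Nat.Solver as ℕ-Solver
open import Data.Product using (∃; _×_; _,_; proj₁; proj₂)
open import Data.Rational as ℚ using (ℚ; mkℚ; 0ℚ; 1ℚ; ½; ↥_; ↧ₙ_; ∣_∣)
open import Data.Rational.Literals using (fromℤ)
import Data.Rational.Properties as ℚₚ
import Data.Rational.Solver as ℚ-Solver
open import Data.Rational.Unnormalised as ℚᵘ using (mkℚᵘ)
import Data.Rational.Unnormalised.Properties as ℚᵘₚ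
open import Data.Sum using (inj₁; inj₂)
open import Data.Vec using (Vec; init; last; lookup; tabulate)
open import Data.Vec.Functional using (foldr)
open import Data.Vec.Relation.Unary.All as All using (All)
open import Data.Vec.Relation.Unary.Any as Any using (Any)
open import Function using (_∘_)
open import Level using (0ℓ)
open import Relation.Binary.PropositionalEquality
open import Relation.Nullary
  using (Dec; does; yes; no; ¬_; ¬?; _×-dec_; _→-dec_; contradiction)
open import Relation.Unary using (Pred; Decidable)

largest≤ : {P : Pred ℕ 0ℓ} → Decidable P → ℕ → ℕ
largest≤ P? zero = zero
largest≤ P? (suc m) with P? (suc m)
... | yes _ = suc m
... | no _  = largest≤ P? m

largest≤-holds : {P : Pred ℕ 0ℓ} (P? : Decidable P) → P zero → ∀ m → P (largest≤ P? m)
largest≤-holds P? P0 zero = P0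
largest≤-holds P? P0 (suc m) with P? (suc m)
... | yes p = p
... | no _  = largest≤-holds P? P0 m

largest≤-maximal : {P : Pred ℕ 0ℓ} (P? : Decidable P) →
                   ∀ m j → j ℕ.≤ m → P j → j ℕ.≤ largest≤ P? m
largest≤-maximal P? zero j j≤m Pj = j≤m
largest≤-maximal P? (suc m) j j≤m Pj with P? (suc m)
... | yes _ = j≤m
... | no ¬p with ℕₚ.m≤n⇒m<n∨m≡n j≤m
...   | inj₁ (ℕ.s≤s j≤m′) = largest≤-maximal P? m j j≤m′ Pj
...   | inj₂ refl = contradiction Pj ¬p

-- j/N ≤ (u/w)^(a/b), with roots and denominators cleared.
FloorAtLeast : (N u w a b : ℕ) → Pred ℕ 0ℓ
FloorAtLeast N u w a b j = (j ℕ.^ b) ℕ.* (w ℕ.^ a) ℕ.≤ (u ℕ.^ a) ℕ.* (N ℕ.^ b)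

floorAtLeast? : ∀ N u w a b → Decidable (FloorAtLeast N u w a b)
floorAtLeast? N u w a b j = _ ℕ.≤? _

-- ⌊ N · (u/w)^(a/b) ⌋; the search bound uᵃNᵇ suffices when b and w are nonzero.
⌊_*[_/_]^[_/_]⌋ : (N u w a b : ℕ) → ℕ
⌊ N *[ u / w ]^[ a / b ]⌋ = largest≤ (floorAtLeast? N u w a b) ((u ℕ.^ a) ℕ.* (N ℕ.^ b))

floor-lower : ∀ N u w a b .{{_ : ℕ.NonZero b}} →
              FloorAtLeast N u w a b ⌊ N *[ u / w ]^[ a / b ]⌋
floor-lower N u w a b@(suc _) = largest≤-holds (floorAtLeast? N u w a b) ℕ.z≤n ((u ℕ.^ a) ℕ.* (N ℕ.^ b))

m≤m^n : ∀ m n .{{_ : ℕ.NonZero n}} → m ℕ.≤ m ℕ.^ n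
m≤m^n zero (suc n) = ℕ.z≤n
m≤m^n m@(suc _) (suc n) = ℕₚ.m≤m*n m (m ℕ.^ n) {{ℕₚ.m^n≢0 m n}}

floor-maximal : ∀ N u w a b .{{_ : ℕ.NonZero w}} .{{_ : ℕ.NonZero b}} j →
                FloorAtLeast N u w a b j → j ℕ.≤ ⌊ N *[ u / w ]^[ a / b ]⌋
floor-maximal N u w a b j h =
  largest≤-maximal (floorAtLeast? N u w a b) _ j
    (ℕₚ.≤-trans (m≤m^n j b) (ℕₚ.≤-trans (ℕₚ.m≤m*n (j ℕ.^ b) (w ℕ.^ a) {{ℕₚ.m^n≢0 w a}}) h)) h

floor-upper : ∀ N u w a b .{{_ : ℕ.NonZero w}} .{{_ : ℕ.NonZero b}} →
              (u ℕ.^ a) ℕ.* (N ℕ.^ b) ℕ.<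
              (suc ⌊ N *[ u / w ]^[ a / b ]⌋ ℕ.^ b) ℕ.* (w ℕ.^ a)
floor-upper N u w a b = ℕₚ.≰⇒> λ h → ℕₚ.1+n≰n (floor-maximal N u w a b _ h)

^-distribʳ-* : ∀ m n o → (m ℕ.* n) ℕ.^ o ≡ (m ℕ.^ o) ℕ.* (n ℕ.^ o)
^-distribʳ-* m n zero = refl
^-distribʳ-* m n (suc o) rewrite ^-distribʳ-* m n o =
  solve 4 (λ a b c d → a :* b :* (c :* d) := a :* c :* (b :* d)) refl m n (m ℕ.^ o) (n ℕ.^ o)
  where open ℕ-Solver.+-*-Solver

^-cancelʳ-≤ : ∀ k .{{_ : ℕ.NonZero k}} {m n} → m ℕ.^ k ℕ.≤ n ℕ.^ k → m ℕ.≤ n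
^-cancelʳ-≤ k h = ℕₚ.≮⇒≥ λ n<m → ℕₚ.<⇒≱ (ℕₚ.^-monoˡ-< k n<m) h

bernoulli : ∀ M L k → (M ℕ.^ k) ℕ.* (M ℕ.+ k ℕ.* L) ℕ.≤ M ℕ.* (M ℕ.+ L) ℕ.^ k
bernoulli M L zero = ℕₚ.≤-reflexive (solve 1 (λ M → con 1 :* (M :+ con 0) := M :* con 1) refl M)
  where open ℕ-Solver.+-*-Solver
bernoulli M L (suc k) = begin
  M ℕ.* X ℕ.* (M ℕ.+ (L ℕ.+ k ℕ.* L))
    ≤⟨ ℕₚ.m≤m+n _ (X ℕ.* (k ℕ.* L ℕ.* L)) ⟩
  M ℕ.* X ℕ.* (M ℕ.+ (L ℕ.+ k ℕ.* L)) ℕ.+ X ℕ.* (k ℕ.* L ℕ.* L)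
    ≡⟨ solve 4 (λ M L K X → M :* X :* (M :+ (L :+ K)) :+ X :* (K :* L)
                          := (M :+ L) :* (X :* (M :+ K))) refl M L (k ℕ.* L) X ⟩
  (M ℕ.+ L) ℕ.* (X ℕ.* (M ℕ.+ k ℕ.* L))
    ≤⟨ ℕₚ.*-monoʳ-≤ (M ℕ.+ L) (bernoulli M L k) ⟩
  (M ℕ.+ L) ℕ.* (M ℕ.* Y)
    ≡⟨ solve 3 (λ A M Y → A :* (M :* Y) := M :* (A :* Y)) refl (M ℕ.+ L) M Y ⟩
  M ℕ.* ((M ℕ.+ L) ℕ.* Y) ∎
  where
  open ℕₚ.≤-Reasoning
  open ℕ-Solver.+-*-Solver
  X = M ℕ.^ k
  Y = (M ℕ.+ L) ℕ.^ k

root-growth : ∀ M .{{_ : ℕ.NonZero M}} L → L ℕ.* M ℕ.^ M ℕ.≤ (M ℕ.+ L) ℕ.^ M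
root-growth M L = ℕₚ.*-cancelˡ-≤ M (begin
  M ℕ.* (L ℕ.* M ℕ.^ M)
    ≤⟨ ℕₚ.m≤m+n _ (M ℕ.^ M ℕ.* M) ⟩
  M ℕ.* (L ℕ.* M ℕ.^ M) ℕ.+ M ℕ.^ M ℕ.* M
    ≡⟨ solve 3 (λ M L X → M :* (L :* X) :+ X :* M := X :* (M :+ M :* L)) refl M L (M ℕ.^ M) ⟩
  (M ℕ.^ M) ℕ.* (M ℕ.+ M ℕ.* L)
    ≤⟨ bernoulli M L M ⟩
  M ℕ.* (M ℕ.+ L) ℕ.^ M ∎)
  where
  open ℕₚ.≤-Reasoning
  open ℕ-Solver.+-*-Solver

power-growth : ∀ M .{{_ : ℕ.NonZero M}} L d K → d ℕ.* M ℕ.≤ K →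
               (L ℕ.^ d) ℕ.* (M ℕ.^ K) ℕ.≤ (M ℕ.+ L) ℕ.^ K
power-growth M L d K dM≤K = begin
  (L ℕ.^ d) ℕ.* (M ℕ.^ K)
    ≡⟨ cong (λ k → (L ℕ.^ d) ℕ.* (M ℕ.^ k)) K≡ ⟩
  (L ℕ.^ d) ℕ.* (M ℕ.^ (M ℕ.* d ℕ.+ e))
    ≡⟨ cong ((L ℕ.^ d) ℕ.*_) (ℕₚ.^-distribˡ-+-* M (M ℕ.* d) e) ⟩
  (L ℕ.^ d) ℕ.* (M ℕ.^ (M ℕ.* d) ℕ.* M ℕ.^ e)
    ≡⟨ sym (ℕₚ.*-assoc (L ℕ.^ d) _ _) ⟩
  (L ℕ.^ d) ℕ.* M ℕ.^ (M ℕ.* d) ℕ.* M ℕ.^ e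
    ≡⟨ cong (λ z → (L ℕ.^ d) ℕ.* z ℕ.* M ℕ.^ e) (sym (ℕₚ.^-*-assoc M M d)) ⟩
  (L ℕ.^ d) ℕ.* (M ℕ.^ M) ℕ.^ d ℕ.* M ℕ.^ e
    ≡⟨ cong (ℕ._* M ℕ.^ e) (sym (^-distribʳ-* L (M ℕ.^ M) d)) ⟩
  (L ℕ.* M ℕ.^ M) ℕ.^ d ℕ.* M ℕ.^ e
    ≤⟨ ℕₚ.*-mono-≤ (ℕₚ.^-monoˡ-≤ d (root-growth M L)) (ℕₚ.^-monoˡ-≤ e (ℕₚ.m≤m+n M L)) ⟩
  ((M ℕ.+ L) ℕ.^ M) ℕ.^ d ℕ.* (M ℕ.+ L) ℕ.^ e
    ≡⟨ cong (ℕ._* (M ℕ.+ L) ℕ.^ e) (ℕₚ.^-*-assoc (M ℕ.+ L) M d) ⟩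
  (M ℕ.+ L) ℕ.^ (M ℕ.* d) ℕ.* (M ℕ.+ L) ℕ.^ e
    ≡⟨ sym (ℕₚ.^-distribˡ-+-* (M ℕ.+ L) (M ℕ.* d) e) ⟩
  (M ℕ.+ L) ℕ.^ (M ℕ.* d ℕ.+ e)
    ≡⟨ cong ((M ℕ.+ L) ℕ.^_) (sym K≡) ⟩
  (M ℕ.+ L) ℕ.^ K ∎
  where
  open ℕₚ.≤-Reasoning
  e = K ℕ.∸ d ℕ.* M
  K≡ : K ≡ M ℕ.* d ℕ.+ e
  K≡ = trans (sym (ℕₚ.m+[n∸m]≡n dM≤K)) (cong (ℕ._+ e) (ℕₚ.*-comm d M))

-- x^(p-q) ≤ (1 + uw/M)^K for x = u/w and |p - q| ≤ K/M, with denominators cleared.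
exponent-shift : ∀ u w .{{_ : ℕ.NonZero u}} .{{_ : ℕ.NonZero w}} M .{{_ : ℕ.NonZero M}} p q K →
                 p ℕ.* M ℕ.≤ q ℕ.* M ℕ.+ K → q ℕ.* M ℕ.≤ p ℕ.* M ℕ.+ K →
                 (u ℕ.^ p) ℕ.* (w ℕ.^ q) ℕ.* (M ℕ.^ K) ℕ.≤
                 (u ℕ.^ q) ℕ.* (w ℕ.^ p) ℕ.* ((M ℕ.+ u ℕ.* w) ℕ.^ K)
exponent-shift u w M p q K h₁ h₂ with ℕₚ.≤-total q p
... | inj₁ q≤p = begin
  U p ℕ.* W q ℕ.* M ℕ.^ K            ≡⟨ cong (λ z → z ℕ.* W q ℕ.* M ℕ.^ K) (split u) ⟩
  U q ℕ.* U d ℕ.* W q ℕ.* M ℕ.^ K    ≤⟨ ℕₚ.m≤m*n _ (W d ℕ.* W d) {{ℕₚ.m*n≢0 (W d) (W d) {{w≢0}} {{w≢0}}}} ⟩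
  U q ℕ.* U d ℕ.* W q ℕ.* M ℕ.^ K ℕ.* (W d ℕ.* W d)
    ≡⟨ solve 5 (λ Uq Ud Wq Wd X → Uq :* Ud :* Wq :* X :* (Wd :* Wd)
                               := Uq :* (Wq :* Wd) :* (Ud :* Wd :* X))
         refl (U q) (U d) (W q) (W d) (M ℕ.^ K) ⟩
  U q ℕ.* (W q ℕ.* W d) ℕ.* (U d ℕ.* W d ℕ.* M ℕ.^ K)
    ≡⟨ cong₂ (λ y z → U q ℕ.* y ℕ.* (z ℕ.* M ℕ.^ K)) (sym (split w)) (sym (^-distribʳ-* u w d)) ⟩
  U q ℕ.* W p ℕ.* ((u ℕ.* w) ℕ.^ d ℕ.* M ℕ.^ K)
    ≤⟨ ℕₚ.*-monoʳ-≤ (U q ℕ.* W p) (power-growth M (u ℕ.* w) d K (dM≤K h₁)) ⟩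
  U q ℕ.* W p ℕ.* (M ℕ.+ u ℕ.* w) ℕ.^ K ∎
  where
  open ℕₚ.≤-Reasoning
  open ℕ-Solver.+-*-Solver
  U W : ℕ → ℕ
  U = u ℕ.^_
  W = w ℕ.^_
  d = p ℕ.∸ q
  w≢0 = ℕₚ.m^n≢0 w d
  split : ∀ x → x ℕ.^ p ≡ x ℕ.^ q ℕ.* x ℕ.^ d
  split x = trans (cong (x ℕ.^_) (sym (ℕₚ.m+[n∸m]≡n q≤p))) (ℕₚ.^-distribˡ-+-* x q d)
  dM≤K : p ℕ.* M ℕ.≤ q ℕ.* M ℕ.+ K → d ℕ.* M ℕ.≤ K
  dM≤K h = subst (ℕ._≤ K) (sym (ℕₚ.*-distribʳ-∸ M p q)) (ℕₚ.m≤n+o⇒m∸n≤o (p ℕ.* M) (q ℕ.* M) h)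
... | inj₂ p≤q = begin
  U p ℕ.* W q ℕ.* M ℕ.^ K            ≡⟨ cong (λ z → U p ℕ.* z ℕ.* M ℕ.^ K) (split w) ⟩
  U p ℕ.* (W p ℕ.* W d) ℕ.* M ℕ.^ K  ≤⟨ ℕₚ.m≤m*n _ (U d ℕ.* U d) {{ℕₚ.m*n≢0 (U d) (U d) {{u≢0}} {{u≢0}}}} ⟩
  U p ℕ.* (W p ℕ.* W d) ℕ.* M ℕ.^ K ℕ.* (U d ℕ.* U d)
    ≡⟨ solve 5 (λ Up Ud Wp Wd X → Up :* (Wp :* Wd) :* X :* (Ud :* Ud)
                               := Up :* Ud :* Wp :* (Ud :* Wd :* X))
         refl (U p) (U d) (W p) (W d) (M ℕ.^ K) ⟩
  U p ℕ.* U d ℕ.* W p ℕ.* (U d ℕ.* W d ℕ.* M ℕ.^ K)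
    ≡⟨ cong₂ (λ y z → y ℕ.* W p ℕ.* (z ℕ.* M ℕ.^ K)) (sym (split u)) (sym (^-distribʳ-* u w d)) ⟩
  U q ℕ.* W p ℕ.* ((u ℕ.* w) ℕ.^ d ℕ.* M ℕ.^ K)
    ≤⟨ ℕₚ.*-monoʳ-≤ (U q ℕ.* W p) (power-growth M (u ℕ.* w) d K (dM≤K h₂)) ⟩
  U q ℕ.* W p ℕ.* (M ℕ.+ u ℕ.* w) ℕ.^ K ∎
  where
  open ℕₚ.≤-Reasoning
  open ℕ-Solver.+-*-Solver
  U W : ℕ → ℕ
  U = u ℕ.^_
  W = w ℕ.^_
  d = q ℕ.∸ p
  u≢0 = ℕₚ.m^n≢0 u d
  split : ∀ x → x ℕ.^ q ≡ x ℕ.^ p ℕ.* x ℕ.^ d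
  split x = trans (cong (x ℕ.^_) (sym (ℕₚ.m+[n∸m]≡n p≤q))) (ℕₚ.^-distribˡ-+-* x p d)
  dM≤K : q ℕ.* M ℕ.≤ p ℕ.* M ℕ.+ K → d ℕ.* M ℕ.≤ K
  dM≤K h = subst (ℕ._≤ K) (sym (ℕₚ.*-distribʳ-∸ M q p)) (ℕₚ.m≤n+o⇒m∸n≤o (q ℕ.* M) (p ℕ.* M) h)

floor-close : ∀ u w .{{_ : ℕ.NonZero u}} .{{_ : ℕ.NonZero w}} M .{{_ : ℕ.NonZero M}}
          a b .{{_ : ℕ.NonZero b}} a′ b′ .{{_ : ℕ.NonZero b′}} N N′ →
          (a ℕ.* b′) ℕ.* M ℕ.≤ (a′ ℕ.* b) ℕ.* M ℕ.+ b ℕ.* b′ →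
          (a′ ℕ.* b) ℕ.* M ℕ.≤ (a ℕ.* b′) ℕ.* M ℕ.+ b ℕ.* b′ →
          ⌊ N *[ u / w ]^[ a / b ]⌋ ℕ.* N′ ℕ.* M ℕ.≤
          suc ⌊ N′ *[ u / w ]^[ a′ / b′ ]⌋ ℕ.* N ℕ.* (M ℕ.+ u ℕ.* w)
floor-close u w M a b a′ b′ N N′ h₁ h₂ = ^-cancelʳ-≤ K {{K≢0}} (ℕₚ.*-cancelʳ-≤ _ _ X {{X≢0}} (begin
  (j ℕ.* N′ ℕ.* M) ℕ.^ K ℕ.* X
    ≡⟨ cong (ℕ._* X) (^3 j N′ M) ⟩
  j ℕ.^ K ℕ.* N′ ℕ.^ K ℕ.* M ℕ.^ K ℕ.* (w ℕ.^ p ℕ.* u ℕ.^ q)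
    ≡⟨ solve 5 (λ J N M W U → J :* N :* M :* (W :* U) := (J :* W) :* (U :* N) :* M)
         refl (j ℕ.^ K) (N′ ℕ.^ K) (M ℕ.^ K) (w ℕ.^ p) (u ℕ.^ q) ⟩
  (j ℕ.^ K ℕ.* w ℕ.^ p) ℕ.* (u ℕ.^ q ℕ.* N′ ℕ.^ K) ℕ.* M ℕ.^ K
    ≤⟨ ℕₚ.*-monoˡ-≤ (M ℕ.^ K) (ℕₚ.*-mono-≤ lower upper) ⟩
  (u ℕ.^ p ℕ.* N ℕ.^ K) ℕ.* (j′ ℕ.^ K ℕ.* w ℕ.^ q) ℕ.* M ℕ.^ K
    ≡⟨ solve 5 (λ U N J W M → U :* N :* (J :* W) :* M := J :* N :* (U :* W :* M))
         refl (u ℕ.^ p) (N ℕ.^ K) (j′ ℕ.^ K) (w ℕ.^ q) (M ℕ.^ K) ⟩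
  j′ ℕ.^ K ℕ.* N ℕ.^ K ℕ.* (u ℕ.^ p ℕ.* w ℕ.^ q ℕ.* M ℕ.^ K)
    ≤⟨ ℕₚ.*-monoʳ-≤ (j′ ℕ.^ K ℕ.* N ℕ.^ K) (exponent-shift u w M p q K h₁ h₂) ⟩
  j′ ℕ.^ K ℕ.* N ℕ.^ K ℕ.* (u ℕ.^ q ℕ.* w ℕ.^ p ℕ.* L ℕ.^ K)
    ≡⟨ solve 5 (λ J N U W L → J :* N :* (U :* W :* L) := J :* N :* L :* (W :* U))
         refl (j′ ℕ.^ K) (N ℕ.^ K) (u ℕ.^ q) (w ℕ.^ p) (L ℕ.^ K) ⟩
  j′ ℕ.^ K ℕ.* N ℕ.^ K ℕ.* L ℕ.^ K ℕ.* X
    ≡⟨ cong (ℕ._* X) (sym (^3 j′ N L)) ⟩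
  (j′ ℕ.* N ℕ.* L) ℕ.^ K ℕ.* X ∎))
  where
  open ℕₚ.≤-Reasoning
  open ℕ-Solver.+-*-Solver
  j = ⌊ N *[ u / w ]^[ a / b ]⌋
  j′ = suc ⌊ N′ *[ u / w ]^[ a′ / b′ ]⌋
  p = a ℕ.* b′
  q = a′ ℕ.* b
  K = b ℕ.* b′
  L = M ℕ.+ u ℕ.* w
  X = w ℕ.^ p ℕ.* u ℕ.^ q
  K≢0 = ℕₚ.m*n≢0 b b′
  X≢0 : ℕ.NonZero X
  X≢0 = ℕₚ.m*n≢0 (w ℕ.^ p) (u ℕ.^ q) {{ℕₚ.m^n≢0 w p}} {{ℕₚ.m^n≢0 u q}}
  ^3 : ∀ x y z → (x ℕ.* y ℕ.* z) ℕ.^ K ≡ x ℕ.^ K ℕ.* y ℕ.^ K ℕ.* z ℕ.^ K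
  ^3 x y z = trans (^-distribʳ-* (x ℕ.* y) z K) (cong (ℕ._* z ℕ.^ K) (^-distribʳ-* x y K))
  ^2 : ∀ x c y d e → (x ℕ.^ c ℕ.* y ℕ.^ d) ℕ.^ e ≡ x ℕ.^ (c ℕ.* e) ℕ.* y ℕ.^ (d ℕ.* e)
  ^2 x c y d e = trans (^-distribʳ-* (x ℕ.^ c) (y ℕ.^ d) e) (cong₂ ℕ._*_ (ℕₚ.^-*-assoc x c e) (ℕₚ.^-*-assoc y d e))
  lower : j ℕ.^ K ℕ.* w ℕ.^ p ℕ.≤ u ℕ.^ p ℕ.* N ℕ.^ K
  lower = subst₂ ℕ._≤_ (^2 j b w a b′) (^2 u a N b b′)
            (ℕₚ.^-monoˡ-≤ b′ (floor-lower N u w a b))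
  upper : u ℕ.^ q ℕ.* N′ ℕ.^ K ℕ.≤ j′ ℕ.^ K ℕ.* w ℕ.^ q
  upper = subst (λ k → u ℕ.^ q ℕ.* N′ ℕ.^ k ℕ.≤ j′ ℕ.^ k ℕ.* w ℕ.^ q) (ℕₚ.*-comm b′ b)
            (subst₂ ℕ._≤_ (^2 u a′ N′ b′ b) (^2 j′ b′ w a′ b)
              (ℕₚ.^-monoˡ-≤ b (ℕₚ.<⇒≤ (floor-upper N′ u w a′ b′))))

0<½ε : ∀ ε → 0ℚ ℚ.< ε → 0ℚ ℚ.< ½ ℚ.* ε
0<½ε ε 0<ε = subst (ℚ._< ½ ℚ.* ε) (ℚₚ.*-zeroʳ ½) (ℚₚ.*-monoʳ-<-pos ½ {x = 0ℚ} {y = ε} 0<ε)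

½+½ : ∀ ε → ½ ℚ.* ε ℚ.+ ½ ℚ.* ε ≡ ε
½+½ ε = trans (sym (ℚₚ.*-distribʳ-+ ε ½ ½)) (ℚₚ.*-identityˡ ε)

½ε<ε : ∀ ε → 0ℚ ℚ.< ε → ½ ℚ.* ε ℚ.< ε
½ε<ε ε 0<ε = subst₂ ℚ._<_ (ℚₚ.+-identityʳ _) (½+½ ε) (ℚₚ.+-monoʳ-< (½ ℚ.* ε) (0<½ε ε 0<ε))

p≤∣p∣ : ∀ p → p ℚ.≤ ∣ p ∣
p≤∣p∣ p with ℚₚ.≤-total 0ℚ p
... | inj₁ 0≤p = ℚₚ.≤-reflexive (sym (ℚₚ.0≤p⇒∣p∣≡p 0≤p))
... | inj₂ p≤0 = ℚₚ.≤-trans p≤0 (ℚₚ.0≤∣p∣ p)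

∣-∣-swap : ∀ p q → ∣ p ℚ.- q ∣ ≡ ∣ q ℚ.- p ∣
∣-∣-swap p q = trans (sym (ℚₚ.∣-p∣≡∣p∣ (p ℚ.- q)))
  (cong ∣_∣ (solve 2 (λ p q → :- (p :- q) := q :- p) refl p q))
  where open ℚ-Solver.+-*-Solver

∣-∣≤⇒≤+ : ∀ {p q ε} → ∣ p ℚ.- q ∣ ℚ.≤ ε → p ℚ.≤ q ℚ.+ ε
∣-∣≤⇒≤+ {p} {q} {ε} h = subst (ℚ._≤ q ℚ.+ ε)
  (solve 2 (λ p q → q :+ (p :- q) := p) refl p q)
  (ℚₚ.+-monoʳ-≤ q (ℚₚ.≤-trans (p≤∣p∣ (p ℚ.- q)) h))
  where open ℚ-Solver.+-*-Solver

∣p∣≤∣q∣+∣p-q∣ : ∀ p q → ∣ p ∣ ℚ.≤ ∣ q ∣ ℚ.+ ∣ p ℚ.- q ∣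
∣p∣≤∣q∣+∣p-q∣ p q = subst (λ z → ∣ z ∣ ℚ.≤ ∣ q ∣ ℚ.+ ∣ p ℚ.- q ∣)
  (solve 2 (λ p q → q :+ (p :- q) := p) refl p q) (ℚₚ.∣p+q∣≤∣p∣+∣q∣ q (p ℚ.- q))
  where open ℚ-Solver.+-*-Solver

≤+⇒∣-∣≤ : ∀ {p q ε} → p ℚ.≤ q ℚ.+ ε → q ℚ.≤ p ℚ.+ ε → ∣ p ℚ.- q ∣ ℚ.≤ ε
≤+⇒∣-∣≤ {p} {q} {ε} h₁ h₂ with ℚₚ.∣p∣≡p∨∣p∣≡-p (p ℚ.- q)
... | inj₁ eq = subst₂ ℚ._≤_ (sym eq)
  (solve 2 (λ q ε → q :+ ε :- q := ε) refl q ε) (ℚₚ.+-monoˡ-≤ (ℚ.- q) h₁)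
  where open ℚ-Solver.+-*-Solver
... | inj₂ eq = subst₂ ℚ._≤_
  (trans (solve 2 (λ p q → q :- p := :- (p :- q)) refl p q) (sym eq))
  (solve 2 (λ p ε → p :+ ε :- p := ε) refl p ε) (ℚₚ.+-monoˡ-≤ (ℚ.- p) h₂)
  where open ℚ-Solver.+-*-Solver

0<1/ : ∀ n .{{_ : ℕ.NonZero n}} → 0ℚ ℚ.< + 1 ℚ./ n
0<1/ n = ℚₚ.positive⁻¹ (+ 1 ℚ./ n) {{ℚₚ.normalize-pos 1 n}}

1/↧≤ : ∀ {ε} → 0ℚ ℚ.< ε → + 1 ℚ./ ↧ₙ ε ℚ.≤ ε
1/↧≤ {ε@(mkℚ n d _)} 0<ε with ℚ.positive 0<ε
1/↧≤ {ε@(mkℚ (+[1+ n ]) d _)} 0<ε | _ =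
  ℚₚ.toℚᵘ-cancel-≤ (ℚᵘₚ.≤-trans (ℚᵘₚ.≤-reflexive (ℚₚ.toℚᵘ-fromℚᵘ (mkℚᵘ (+ 1) d)))
    (ℚᵘ.*≤* (ℤₚ.*-monoʳ-≤-nonNeg (+ suc d) {+ 1} {+[1+ n ]} (ℤ.+≤+ (ℕ.s≤s ℕ.z≤n)))))

frac-≤ : ∀ {j N i M D} .{{_ : ℕ.NonZero N}} .{{_ : ℕ.NonZero M}} .{{_ : ℕ.NonZero D}} →
         j ℕ.* (M ℕ.* D) ℕ.≤ (i ℕ.* D ℕ.+ 1 ℕ.* M) ℕ.* N →
         + j ℚ./ N ℚ.≤ + i ℚ./ M ℚ.+ + 1 ℚ./ D
frac-≤ {j} {suc N} {i} {suc M} {suc D} h = ℚₚ.toℚᵘ-cancel-≤ (begin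
  ℚ.toℚᵘ (+ j ℚ./ suc N)                 ≃⟨ ℚₚ.toℚᵘ-fromℚᵘ (mkℚᵘ (+ j) N) ⟩
  mkℚᵘ (+ j) N                           ≤⟨ ℚᵘ.*≤* (subst₂ ℤ._≤_ (ℤₚ.pos-* j _) eq (ℤ.+≤+ h)) ⟩
  mkℚᵘ (+ i) M ℚᵘ.+ mkℚᵘ (+ 1) D
    ≃⟨ ℚᵘₚ.+-cong (ℚᵘₚ.≃-sym (ℚₚ.toℚᵘ-fromℚᵘ (mkℚᵘ (+ i) M))) (ℚᵘₚ.≃-sym (ℚₚ.toℚᵘ-fromℚᵘ (mkℚᵘ (+ 1) D))) ⟩
  ℚ.toℚᵘ (+ i ℚ./ suc M) ℚᵘ.+ ℚ.toℚᵘ (+ 1 ℚ./ suc D)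
    ≃⟨ ℚᵘₚ.≃-sym (ℚₚ.toℚᵘ-homo-+ (+ i ℚ./ suc M) (+ 1 ℚ./ suc D)) ⟩
  ℚ.toℚᵘ (+ i ℚ./ suc M ℚ.+ + 1 ℚ./ suc D) ∎)
  where
  open ℚᵘₚ.≤-Reasoning
  eq : + ((i ℕ.* suc D ℕ.+ 1 ℕ.* suc M) ℕ.* suc N) ≡ (+ i ℤ.* + suc D ℤ.+ + 1 ℤ.* + suc M) ℤ.* + suc N
  eq = trans (ℤₚ.pos-* (i ℕ.* suc D ℕ.+ 1 ℕ.* suc M) (suc N))
         (cong (ℤ._* + suc N) (trans (ℤₚ.pos-+ (i ℕ.* suc D) (1 ℕ.* suc M))
           (cong₂ ℤ._+_ (ℤₚ.pos-* i (suc D)) (ℤₚ.pos-* 1 (suc M)))))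

num : ℚ → ℕ
num p = ℤ.∣ ↥ p ∣

frac-≤⁻¹ : ∀ p q M .{{_ : ℕ.NonZero M}} → ∣ p ∣ ℚ.≤ ∣ q ∣ ℚ.+ + 1 ℚ./ M →
           num p ℕ.* (↧ₙ q ℕ.* M) ℕ.≤ (num q ℕ.* M ℕ.+ 1 ℕ.* ↧ₙ q) ℕ.* ↧ₙ p
frac-≤⁻¹ p@(mkℚ m c _) q@(mkℚ n d _) (suc M) h = ℤ.drop‿+≤+
  (subst₂ ℤ._≤_ (sym (ℤₚ.pos-* (num p) (↧ₙ q ℕ.* suc M))) (sym eq) (ℚᵘₚ.drop-*≤* h′))
  where
  open ℚᵘₚ.≤-Reasoning
  h′ : mkℚᵘ (+ num p) c ℚᵘ.≤ mkℚᵘ (+ num q) d ℚᵘ.+ mkℚᵘ (+ 1) M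
  h′ = begin
    ℚ.toℚᵘ ∣ p ∣                             ≤⟨ ℚₚ.toℚᵘ-mono-≤ h ⟩
    ℚ.toℚᵘ (∣ q ∣ ℚ.+ + 1 ℚ./ suc M)         ≃⟨ ℚₚ.toℚᵘ-homo-+ ∣ q ∣ (+ 1 ℚ./ suc M) ⟩
    ℚ.toℚᵘ ∣ q ∣ ℚᵘ.+ ℚ.toℚᵘ (+ 1 ℚ./ suc M) ≃⟨ ℚᵘₚ.+-congʳ (ℚ.toℚᵘ ∣ q ∣) (ℚₚ.toℚᵘ-fromℚᵘ (mkℚᵘ (+ 1) M)) ⟩
    ℚ.toℚᵘ ∣ q ∣ ℚᵘ.+ mkℚᵘ (+ 1) M ∎
  eq : + ((num q ℕ.* suc M ℕ.+ 1 ℕ.* ↧ₙ q) ℕ.* ↧ₙ p) ≡ (+ num q ℤ.* + suc M ℤ.+ + 1 ℤ.* + ↧ₙ q) ℤ.* + ↧ₙ p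
  eq = trans (ℤₚ.pos-* (num q ℕ.* suc M ℕ.+ 1 ℕ.* ↧ₙ q) (↧ₙ p))
         (cong (ℤ._* + ↧ₙ p) (trans (ℤₚ.pos-+ (num q ℕ.* suc M) (1 ℕ.* ↧ₙ q))
           (cong₂ ℤ._+_ (ℤₚ.pos-* (num q) (suc M)) (ℤₚ.pos-* 1 (↧ₙ q)))))

near-ℕ : ∀ p q M .{{_ : ℕ.NonZero M}} → ∣ p ℚ.- q ∣ ℚ.< + 1 ℚ./ M →
         num p ℕ.* ↧ₙ q ℕ.* M ℕ.≤ num q ℕ.* ↧ₙ p ℕ.* M ℕ.+ ↧ₙ p ℕ.* ↧ₙ q
near-ℕ p q M h = begin
  num p ℕ.* ↧ₙ q ℕ.* M
    ≡⟨ ℕₚ.*-assoc (num p) (↧ₙ q) M ⟩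
  num p ℕ.* (↧ₙ q ℕ.* M)
    ≤⟨ frac-≤⁻¹ p q M (ℚₚ.≤-trans {∣ p ∣} {∣ q ∣ ℚ.+ ∣ p ℚ.- q ∣} {∣ q ∣ ℚ.+ + 1 ℚ./ M} (∣p∣≤∣q∣+∣p-q∣ p q)
        (ℚₚ.+-monoʳ-≤ ∣ q ∣ {∣ p ℚ.- q ∣} {+ 1 ℚ./ M} (ℚₚ.<⇒≤ h))) ⟩
  (num q ℕ.* M ℕ.+ 1 ℕ.* ↧ₙ q) ℕ.* ↧ₙ p
    ≡⟨ solve 4 (λ a M b c → (a :* M :+ con 1 :* b) :* c := a :* c :* M :+ c :* b) refl
        (num q) M (↧ₙ q) (↧ₙ p) ⟩
  num q ℕ.* ↧ₙ p ℕ.* M ℕ.+ ↧ₙ p ℕ.* ↧ₙ q ∎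
  where
  open ℕₚ.≤-Reasoning
  open ℕ-Solver.+-*-Solver

IsCauchy : (ℕ → ℚ) → Set
IsCauchy f = ∀ ε → 0ℚ ℚ.< ε → ∃ λ N → ∀ m n → N ℕ.≤ m → N ℕ.≤ n → ∣ f m ℚ.- f n ∣ ℚ.< ε

-- The Cauchy completion of ℚ: Cauchy sequences with a modulus, ordered by their limits.
record ℝ : Set where
  constructor mkℝ
  field
    seq    : ℕ → ℚ
    cauchy : IsCauchy seq

open ℝ public

infix 4 _≤_ _<_

_≤_ : ℝ → ℝ → Set
x ≤ y = ∀ ε → 0ℚ ℚ.< ε → ∃ λ N → ∀ n → N ℕ.≤ n → seq x n ℚ.≤ seq y n ℚ.+ ε

_<_ : ℝ → ℝ → Set
x < y = ∃ λ ε → 0ℚ ℚ.< ε × ∃ λ N → ∀ n → N ℕ.≤ n → seq x n ℚ.+ ε ℚ.≤ seq y n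

fromℚ : ℚ → ℝ
fromℚ p = mkℝ (λ _ → p) λ ε 0<ε → 0 , λ _ _ _ _ →
  subst (ℚ._< ε) (sym (cong ∣_∣ (ℚₚ.+-inverseʳ p))) 0<ε

0ℝ 1ℝ : ℝ
0ℝ = fromℚ 0ℚ
1ℝ = fromℚ 1ℚ

one-sided⇒cauchy : ∀ f → (∀ ε → 0ℚ ℚ.< ε → ∃ λ N → ∀ m n → N ℕ.≤ m → N ℕ.≤ n → f m ℚ.≤ f n ℚ.+ ε) → IsCauchy f
one-sided⇒cauchy f h ε 0<ε with h (½ ℚ.* ε) (0<½ε ε 0<ε)
... | N , k = N , λ m n N≤m N≤n →
  ℚₚ.≤-<-trans (≤+⇒∣-∣≤ (k m n N≤m N≤n) (k n m N≤n N≤m)) (½ε<ε ε 0<ε)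

infixl 6 _+_ _-_
infixl 7 _*_
infix  8 -_

_+_ : ℝ → ℝ → ℝ
seq (x + y) n = seq x n ℚ.+ seq y n
cauchy (x + y) ε 0<ε with cauchy x (½ ℚ.* ε) (0<½ε ε 0<ε) | cauchy y (½ ℚ.* ε) (0<½ε ε 0<ε)
... | N , h | M , k = N ℕ.⊔ M , λ m n m≥ n≥ → begin-strict
  ∣ seq x m ℚ.+ seq y m ℚ.- (seq x n ℚ.+ seq y n) ∣
    ≡⟨ cong ∣_∣ (solve 4 (λ a b c d → a :+ b :- (c :+ d) := (a :- c) :+ (b :- d)) refl
         (seq x m) (seq y m) (seq x n) (seq y n)) ⟩
  ∣ (seq x m ℚ.- seq x n) ℚ.+ (seq y m ℚ.- seq y n) ∣
    ≤⟨ ℚₚ.∣p+q∣≤∣p∣+∣q∣ (seq x m ℚ.- seq x n) (seq y m ℚ.- seq y n) ⟩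
  ∣ seq x m ℚ.- seq x n ∣ ℚ.+ ∣ seq y m ℚ.- seq y n ∣
    <⟨ ℚₚ.+-mono-< (h m n (ℕₚ.m⊔n≤o⇒m≤o N M m≥) (ℕₚ.m⊔n≤o⇒m≤o N M n≥))
                   (k m n (ℕₚ.m⊔n≤o⇒n≤o N M m≥) (ℕₚ.m⊔n≤o⇒n≤o N M n≥)) ⟩
  ½ ℚ.* ε ℚ.+ ½ ℚ.* ε  ≡⟨ ½+½ ε ⟩
  ε ∎
  where
  open ℚₚ.≤-Reasoning
  open ℚ-Solver.+-*-Solver

-_ : ℝ → ℝ
seq (- x) n = ℚ.- seq x n
cauchy (- x) ε 0<ε with cauchy x ε 0<ε
... | N , h = N , λ m n m≥ n≥ → subst (ℚ._< ε)
  (trans (∣-∣-swap (seq x m) (seq x n))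
    (cong ∣_∣ (solve 2 (λ a b → b :- a := :- a :- (:- b)) refl (seq x m) (seq x n))))
  (h m n m≥ n≥)
  where open ℚ-Solver.+-*-Solver

_-_ : ℝ → ℝ → ℝ
x - y = x + (- y)

bounded : ∀ x → ∃ λ B → 0ℚ ℚ.< B × ∃ λ N → ∀ n → N ℕ.≤ n → ∣ seq x n ∣ ℚ.≤ B
bounded x with cauchy x 1ℚ (0<1/ 1)
... | N , h = ∣ seq x N ∣ ℚ.+ 1ℚ , ℚₚ.+-mono-≤-< (ℚₚ.0≤∣p∣ (seq x N)) (0<1/ 1) , N , λ n n≥ →
  ℚₚ.≤-trans (∣p∣≤∣q∣+∣p-q∣ (seq x n) (seq x N))
    (ℚₚ.+-monoʳ-≤ ∣ seq x N ∣ (ℚₚ.<⇒≤ (h n N n≥ ℕₚ.≤-refl)))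

quotient : ∀ ε B → 0ℚ ℚ.< ε → 0ℚ ℚ.< B → ∃ λ δ → 0ℚ ℚ.< δ × B ℚ.* δ ≡ ε
quotient ε B 0<ε 0<B = δ , 0<δ , (begin
  B ℚ.* (ℚ.1/ B ℚ.* ε)  ≡⟨ sym (ℚₚ.*-assoc B (ℚ.1/ B) ε) ⟩
  B ℚ.* ℚ.1/ B ℚ.* ε    ≡⟨ cong (ℚ._* ε) (ℚₚ.*-inverseʳ B) ⟩
  1ℚ ℚ.* ε              ≡⟨ ℚₚ.*-identityˡ ε ⟩
  ε ∎)
  where
  open ≡-Reasoning
  instance
    B⁺ : ℚ.Positive B
    B⁺ = ℚ.positive 0<B
    B≢0 : ℚ.NonZero B
    B≢0 = ℚₚ.pos⇒nonZero B
  δ = ℚ.1/ B ℚ.* ε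
  0<δ : 0ℚ ℚ.< δ
  0<δ = subst (ℚ._< δ) (ℚₚ.*-zeroʳ (ℚ.1/ B)) (ℚₚ.*-monoʳ-<-pos (ℚ.1/ B) {{ℚₚ.1/pos⇒pos B}} 0<ε)

∣*∣-mono : ∀ p q P Q → ∣ p ∣ ℚ.≤ P → ∣ q ∣ ℚ.≤ Q → ∣ p ℚ.* q ∣ ℚ.≤ P ℚ.* Q
∣*∣-mono p q P Q h k = begin
  ∣ p ℚ.* q ∣        ≡⟨ ℚₚ.∣p*q∣≡∣p∣*∣q∣ p q ⟩
  ∣ p ∣ ℚ.* ∣ q ∣    ≤⟨ ℚₚ.*-monoˡ-≤-nonNeg ∣ p ∣ {{ℚₚ.∣-∣-nonNeg p}} k ⟩
  ∣ p ∣ ℚ.* Q        ≤⟨ ℚₚ.*-monoʳ-≤-nonNeg Q {{ℚ.nonNegative (ℚₚ.≤-trans (ℚₚ.0≤∣p∣ q) k)}} h ⟩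
  P ℚ.* Q            ∎
  where open ℚₚ.≤-Reasoning

*-close : ∀ a b c d B C δ η → ∣ a ∣ ℚ.≤ B → ∣ d ∣ ℚ.≤ C → ∣ b ℚ.- d ∣ ℚ.≤ δ → ∣ a ℚ.- c ∣ ℚ.≤ η →
          ∣ a ℚ.* b ℚ.- c ℚ.* d ∣ ℚ.≤ B ℚ.* δ ℚ.+ C ℚ.* η
*-close a b c d B C δ η a≤ d≤ bd≤ ac≤ = begin
  ∣ a ℚ.* b ℚ.- c ℚ.* d ∣
    ≡⟨ cong ∣_∣ (solve 4 (λ a b c d → a :* b :- c :* d := a :* (b :- d) :+ d :* (a :- c)) refl a b c d) ⟩
  ∣ a ℚ.* (b ℚ.- d) ℚ.+ d ℚ.* (a ℚ.- c) ∣
    ≤⟨ ℚₚ.∣p+q∣≤∣p∣+∣q∣ (a ℚ.* (b ℚ.- d)) (d ℚ.* (a ℚ.- c)) ⟩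
  ∣ a ℚ.* (b ℚ.- d) ∣ ℚ.+ ∣ d ℚ.* (a ℚ.- c) ∣
    ≤⟨ ℚₚ.+-mono-≤ (∣*∣-mono a (b ℚ.- d) B δ a≤ bd≤) (∣*∣-mono d (a ℚ.- c) C η d≤ ac≤) ⟩
  B ℚ.* δ ℚ.+ C ℚ.* η ∎
  where
  open ℚₚ.≤-Reasoning
  open ℚ-Solver.+-*-Solver

_*_ : ℝ → ℝ → ℝ
seq (x * y) n = seq x n ℚ.* seq y n
cauchy (x * y) ε 0<ε =
  let B , 0<B , N₁ , hx = bounded x
      C , 0<C , N₂ , hy = bounded y
      ε′ = ½ ℚ.* ε
      0<ε′ = 0<½ε ε 0<ε
      δ , 0<δ , Bδ≡ = quotient (½ ℚ.* ε′) B (0<½ε ε′ 0<ε′) 0<B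
      η , 0<η , Cη≡ = quotient (½ ℚ.* ε′) C (0<½ε ε′ 0<ε′) 0<C
      N₃ , ky = cauchy y δ 0<δ
      N₄ , kx = cauchy x η 0<η
      left  : ∀ {k} → (N₁ ℕ.⊔ N₂) ℕ.⊔ (N₃ ℕ.⊔ N₄) ℕ.≤ k → N₁ ℕ.⊔ N₂ ℕ.≤ k
      left  = ℕₚ.m⊔n≤o⇒m≤o (N₁ ℕ.⊔ N₂) (N₃ ℕ.⊔ N₄)
      right : ∀ {k} → (N₁ ℕ.⊔ N₂) ℕ.⊔ (N₃ ℕ.⊔ N₄) ℕ.≤ k → N₃ ℕ.⊔ N₄ ℕ.≤ k
      right = ℕₚ.m⊔n≤o⇒n≤o (N₁ ℕ.⊔ N₂) (N₃ ℕ.⊔ N₄)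
  in (N₁ ℕ.⊔ N₂) ℕ.⊔ (N₃ ℕ.⊔ N₄) , λ m n m≥ n≥ → ℚₚ.≤-<-trans
    (*-close (seq x m) (seq y m) (seq x n) (seq y n) B C δ η
      (hx m (ℕₚ.m⊔n≤o⇒m≤o N₁ N₂ (left m≥)))
      (hy n (ℕₚ.m⊔n≤o⇒n≤o N₁ N₂ (left n≥)))
      (ℚₚ.<⇒≤ (ky m n (ℕₚ.m⊔n≤o⇒m≤o N₃ N₄ (right m≥)) (ℕₚ.m⊔n≤o⇒m≤o N₃ N₄ (right n≥))))
      (ℚₚ.<⇒≤ (kx m n (ℕₚ.m⊔n≤o⇒n≤o N₃ N₄ (right m≥)) (ℕₚ.m⊔n≤o⇒n≤o N₃ N₄ (right n≥)))))
    (subst (ℚ._< ε) (sym (trans (cong₂ ℚ._+_ Bδ≡ Cη≡) (½+½ ε′))) (½ε<ε ε 0<ε))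

-- A sequence with positive limit may still vanish at finitely many indices.
inverse : ℚ → ℚ
inverse p with p ℚ.≟ 0ℚ
... | yes _  = 0ℚ
... | no p≢0 = (ℚ.1/ p) {{ℚ.≢-nonZero p≢0}}

inverse-*ˡ : ∀ p → 0ℚ ℚ.< p → inverse p ℚ.* p ≡ 1ℚ
inverse-*ˡ p 0<p with p ℚ.≟ 0ℚ
... | yes refl = contradiction 0<p (ℚₚ.<-irrefl refl)
... | no p≢0   = ℚₚ.*-inverseˡ p {{ℚ.≢-nonZero p≢0}}

*-cancel-< : ∀ {p q r} → 0ℚ ℚ.≤ r → r ℚ.* p ℚ.< r ℚ.* q → p ℚ.< q
*-cancel-< {r = r} 0≤r = ℚₚ.*-cancelˡ-<-nonNeg r {{ℚ.nonNegative 0≤r}}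

_⁻¹[_] : (x : ℝ) → 0ℝ < x → ℝ
seq (x ⁻¹[ _ ]) n = inverse (seq x n)
cauchy (x ⁻¹[ c , 0<c , N , h ]) ε 0<ε with cauchy x δ 0<δ
  where
  0<cc = ℚₚ.positive⁻¹ (c ℚ.* c) {{ℚₚ.pos*pos⇒pos c {{ℚ.positive 0<c}} c {{ℚ.positive 0<c}}}}
  δ = (c ℚ.* c) ℚ.* ε
  0<δ = ℚₚ.positive⁻¹ δ {{ℚₚ.pos*pos⇒pos (c ℚ.* c) {{ℚ.positive 0<cc}} ε {{ℚ.positive 0<ε}}}}
... | M , k = N ℕ.⊔ M , λ m n m≥ n≥ →
  close (seq x m) (seq x n) (c≤ m (ℕₚ.m⊔n≤o⇒m≤o N M m≥)) (c≤ n (ℕₚ.m⊔n≤o⇒m≤o N M n≥))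
    (k m n (ℕₚ.m⊔n≤o⇒n≤o N M m≥) (ℕₚ.m⊔n≤o⇒n≤o N M n≥))
  where
  c≤ : ∀ n → N ℕ.≤ n → c ℚ.≤ seq x n
  c≤ n n≥ = subst (ℚ._≤ seq x n) (ℚₚ.+-identityˡ c) (h n n≥)
  close : ∀ p q → c ℚ.≤ p → c ℚ.≤ q → ∣ p ℚ.- q ∣ ℚ.< (c ℚ.* c) ℚ.* ε →
          ∣ inverse p ℚ.- inverse q ∣ ℚ.< ε
  close p q c≤p c≤q pq = *-cancel-< (ℚₚ.<⇒≤ 0<pq) (begin-strict
    p ℚ.* q ℚ.* ∣ p′ ℚ.- q′ ∣
      ≡⟨ cong (ℚ._* ∣ p′ ℚ.- q′ ∣) (sym (ℚₚ.0≤p⇒∣p∣≡p (ℚₚ.<⇒≤ 0<pq))) ⟩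
    ∣ p ℚ.* q ∣ ℚ.* ∣ p′ ℚ.- q′ ∣
      ≡⟨ sym (ℚₚ.∣p*q∣≡∣p∣*∣q∣ (p ℚ.* q) (p′ ℚ.- q′)) ⟩
    ∣ p ℚ.* q ℚ.* (p′ ℚ.- q′) ∣
      ≡⟨ cong ∣_∣ (solve 4 (λ p q a b → p :* q :* (a :- b) := a :* p :* q :- b :* q :* p) refl p q p′ q′) ⟩
    ∣ p′ ℚ.* p ℚ.* q ℚ.- q′ ℚ.* q ℚ.* p ∣
      ≡⟨ cong₂ (λ a b → ∣ a ℚ.* q ℚ.- b ℚ.* p ∣) (inverse-*ˡ p 0<p) (inverse-*ˡ q 0<q) ⟩
    ∣ 1ℚ ℚ.* q ℚ.- 1ℚ ℚ.* p ∣
      ≡⟨ cong₂ (λ a b → ∣ a ℚ.- b ∣) (ℚₚ.*-identityˡ q) (ℚₚ.*-identityˡ p) ⟩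
    ∣ q ℚ.- p ∣  ≡⟨ ∣-∣-swap q p ⟩
    ∣ p ℚ.- q ∣  <⟨ pq ⟩
    c ℚ.* c ℚ.* ε
      ≤⟨ ℚₚ.*-monoʳ-≤-nonNeg ε {{ℚ.nonNegative (ℚₚ.<⇒≤ 0<ε)}}
          (ℚₚ.≤-trans (ℚₚ.*-monoʳ-≤-nonNeg c {{ℚ.nonNegative (ℚₚ.<⇒≤ 0<c)}} c≤p)
                      (ℚₚ.*-monoˡ-≤-nonNeg p {{ℚ.nonNegative (ℚₚ.<⇒≤ 0<p)}} c≤q)) ⟩
    p ℚ.* q ℚ.* ε ∎)
    where
    open ℚₚ.≤-Reasoning
    open ℚ-Solver.+-*-Solver
    p′ = inverse p
    q′ = inverse q
    0<p = ℚₚ.<-≤-trans 0<c c≤p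
    0<q = ℚₚ.<-≤-trans 0<c c≤q
    0<pq = ℚₚ.positive⁻¹ (p ℚ.* q) {{ℚₚ.pos*pos⇒pos p {{ℚ.positive 0<p}} q {{ℚ.positive 0<q}}}}

floor-bounded : ∀ N u w .{{_ : ℕ.NonZero u}} .{{_ : ℕ.NonZero w}} a b .{{_ : ℕ.NonZero b}} A →
                a ℕ.≤ A ℕ.* b → ⌊ N *[ u / w ]^[ a / b ]⌋ ℕ.≤ (u ℕ.* w) ℕ.^ A ℕ.* N
floor-bounded N u w a b A h = ^-cancelʳ-≤ b (begin
  j ℕ.^ b                      ≤⟨ ℕₚ.m≤m*n (j ℕ.^ b) (w ℕ.^ a) {{ℕₚ.m^n≢0 w a}} ⟩
  j ℕ.^ b ℕ.* w ℕ.^ a          ≤⟨ floor-lower N u w a b ⟩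
  u ℕ.^ a ℕ.* N ℕ.^ b          ≤⟨ ℕₚ.*-monoˡ-≤ (N ℕ.^ b) (ℕₚ.^-monoˡ-≤ a (ℕₚ.m≤m*n u w)) ⟩
  L ℕ.^ a ℕ.* N ℕ.^ b          ≤⟨ ℕₚ.*-monoˡ-≤ (N ℕ.^ b) (ℕₚ.^-monoʳ-≤ L {{ℕₚ.m*n≢0 u w}} h) ⟩
  L ℕ.^ (A ℕ.* b) ℕ.* N ℕ.^ b  ≡⟨ cong (ℕ._* N ℕ.^ b) (sym (ℕₚ.^-*-assoc L A b)) ⟩
  (L ℕ.^ A) ℕ.^ b ℕ.* N ℕ.^ b  ≡⟨ sym (^-distribʳ-* (L ℕ.^ A) N b) ⟩
  (L ℕ.^ A ℕ.* N) ℕ.^ b        ∎)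
  where
  open ℕₚ.≤-Reasoning
  j = ⌊ N *[ u / w ]^[ a / b ]⌋
  L = u ℕ.* w

estimate : ∀ j j′ N N′ B L .{{_ : ℕ.NonZero L}} D .{{_ : ℕ.NonZero D}} →
           let M = 2 ℕ.* (suc B ℕ.* L ℕ.* D) in
           j ℕ.* N′ ℕ.* M ℕ.≤ suc j′ ℕ.* N ℕ.* (M ℕ.+ L) →
           j′ ℕ.≤ B ℕ.* N′ → 2 ℕ.* D ℕ.≤ N′ →
           j ℕ.* (N′ ℕ.* D) ℕ.≤ (j′ ℕ.* D ℕ.+ 1 ℕ.* N′) ℕ.* N
estimate j j′ N N′ B L D h hB hD = ℕₚ.*-cancelˡ-≤ (2 ℕ.* C) {{2C≢0}} (begin
  2 ℕ.* C ℕ.* (j ℕ.* (N′ ℕ.* D))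
    ≡⟨ solve 4 (λ C j N D → con 2 :* C :* (j :* (N :* D)) := j :* N :* (con 2 :* (C :* D))) refl C j N′ D ⟩
  j ℕ.* N′ ℕ.* (2 ℕ.* (C ℕ.* D))
    ≤⟨ h ⟩
  suc j′ ℕ.* N ℕ.* (2 ℕ.* (C ℕ.* D) ℕ.+ L)
    ≡⟨ solve 5 (λ j N C D L → (con 1 :+ j) :* N :* (con 2 :* (C :* D) :+ L)
         := con 2 :* C :* j :* D :* N :+ C :* N :* (con 2 :* D) :+ N :* L :* j :+ N :* L) refl j′ N C D L ⟩
  2 ℕ.* C ℕ.* j′ ℕ.* D ℕ.* N ℕ.+ C ℕ.* N ℕ.* (2 ℕ.* D) ℕ.+ N ℕ.* L ℕ.* j′ ℕ.+ N ℕ.* L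
    ≤⟨ ℕₚ.+-mono-≤ (ℕₚ.+-mono-≤ (ℕₚ.+-monoʳ-≤ (2 ℕ.* C ℕ.* j′ ℕ.* D ℕ.* N) (ℕₚ.*-monoʳ-≤ (C ℕ.* N) hD))
         (ℕₚ.*-monoʳ-≤ (N ℕ.* L) hB)) (ℕₚ.m≤m*n (N ℕ.* L) N′ {{N′≢0}}) ⟩
  2 ℕ.* C ℕ.* j′ ℕ.* D ℕ.* N ℕ.+ C ℕ.* N ℕ.* N′ ℕ.+ N ℕ.* L ℕ.* (B ℕ.* N′) ℕ.+ N ℕ.* L ℕ.* N′
    ≡⟨ solve 6 (λ j D N N′ B L → let C = (con 1 :+ B) :* L in
         con 2 :* C :* j :* D :* N :+ C :* N :* N′ :+ N :* L :* (B :* N′) :+ N :* L :* N′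
         := con 2 :* C :* ((j :* D :+ con 1 :* N′) :* N)) refl j′ D N N′ B L ⟩
  2 ℕ.* C ℕ.* ((j′ ℕ.* D ℕ.+ 1 ℕ.* N′) ℕ.* N) ∎)
  where
  open ℕₚ.≤-Reasoning
  open ℕ-Solver.+-*-Solver
  C = suc B ℕ.* L
  2C≢0 = ℕₚ.m*n≢0 2 C {{_}} {{ℕₚ.m*n≢0 (suc B) L}}
  N′≢0 : ℕ.NonZero N′
  N′≢0 = ℕ.>-nonZero (ℕₚ.≤-trans (ℕₚ.≤-trans (ℕ.>-nonZero⁻¹ D) (ℕₚ.m≤n*m D 2)) hD)

bound-ℕ : ∀ a b a₀ b₀ .{{_ : ℕ.NonZero b₀}} →
          a ℕ.* b₀ ℕ.* 1 ℕ.≤ a₀ ℕ.* b ℕ.* 1 ℕ.+ b ℕ.* b₀ → a ℕ.≤ suc a₀ ℕ.* b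
bound-ℕ a b a₀ b₀ h = ℕₚ.*-cancelʳ-≤ a (suc a₀ ℕ.* b) b₀ (begin
  a ℕ.* b₀                          ≡⟨ sym (ℕₚ.*-identityʳ _) ⟩
  a ℕ.* b₀ ℕ.* 1                    ≤⟨ h ⟩
  a₀ ℕ.* b ℕ.* 1 ℕ.+ b ℕ.* b₀       ≤⟨ ℕₚ.+-monoˡ-≤ (b ℕ.* b₀) (ℕₚ.*-monoʳ-≤ (a₀ ℕ.* b) (ℕ.>-nonZero⁻¹ b₀)) ⟩
  a₀ ℕ.* b ℕ.* b₀ ℕ.+ b ℕ.* b₀
    ≡⟨ solve 3 (λ a b c → a :* b :* c :+ b :* c := (con 1 :+ a) :* b :* c) refl a₀ b b₀ ⟩
  suc a₀ ℕ.* b ℕ.* b₀ ∎)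
  where
  open ℕₚ.≤-Reasoning
  open ℕ-Solver.+-*-Solver

module _ (u w : ℕ) .{{u≢0 : ℕ.NonZero u}} .{{w≢0 : ℕ.NonZero w}} (α : ℝ) where

  powFloor : ℕ → ℕ
  powFloor n = ⌊ suc n *[ u / w ]^[ num (seq α n) / ↧ₙ seq α n ]⌋

  -- (u/w)^|αₙ|, rounded down to a multiple of 1/(n+1).
  powSeq : ℕ → ℚ
  powSeq n = + powFloor n ℚ./ suc n

  powSeq-cauchy : IsCauchy powSeq
  powSeq-cauchy = one-sided⇒cauchy powSeq λ ε 0<ε →
    let D = ↧ₙ ε
        L = u ℕ.* w
        N₁ , h₁ = cauchy α (+ 1 ℚ./ 1) (0<1/ 1)
        A = suc (num (seq α N₁))
        B = L ℕ.^ A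
        M = 2 ℕ.* (suc B ℕ.* L ℕ.* D)
        L≢0 = ℕₚ.m*n≢0 u w
        M≢0 = ℕₚ.m*n≢0 2 (suc B ℕ.* L ℕ.* D) {{_}}
                {{ℕₚ.m*n≢0 (suc B ℕ.* L) D {{ℕₚ.m*n≢0 (suc B) L {{_}} {{L≢0}}}}}}
        N₂ , h₂ = cauchy α ((+ 1 ℚ./ M) {{M≢0}}) (0<1/ M {{M≢0}})
        ≥N₁ : ∀ {k} → (N₁ ℕ.⊔ N₂) ℕ.⊔ (2 ℕ.* D) ℕ.≤ k → N₁ ℕ.≤ k
        ≥N₁ h = ℕₚ.m⊔n≤o⇒m≤o N₁ N₂ (ℕₚ.m⊔n≤o⇒m≤o (N₁ ℕ.⊔ N₂) (2 ℕ.* D) h)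
        ≥N₂ : ∀ {k} → (N₁ ℕ.⊔ N₂) ℕ.⊔ (2 ℕ.* D) ℕ.≤ k → N₂ ℕ.≤ k
        ≥N₂ h = ℕₚ.m⊔n≤o⇒n≤o N₁ N₂ (ℕₚ.m⊔n≤o⇒m≤o (N₁ ℕ.⊔ N₂) (2 ℕ.* D) h)
    in (N₁ ℕ.⊔ N₂) ℕ.⊔ (2 ℕ.* D) , λ m n m≥ n≥ →
      ℚₚ.≤-trans {powSeq m} {powSeq n ℚ.+ + 1 ℚ./ D} {powSeq n ℚ.+ ε}
        (frac-≤ {powFloor m} {suc m} {powFloor n} {suc n} {D}
          (estimate (powFloor m) (powFloor n) (suc m) (suc n) B L {{L≢0}} D
            (floor-close u w M {{M≢0}} (num (seq α m)) (↧ₙ seq α m) (num (seq α n)) (↧ₙ seq α n) (suc m) (suc n)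
              (near-ℕ (seq α m) (seq α n) M {{M≢0}} (h₂ m n (≥N₂ m≥) (≥N₂ n≥)))
              (subst (λ k → num (seq α n) ℕ.* ↧ₙ seq α m ℕ.* M ℕ.≤ num (seq α m) ℕ.* ↧ₙ seq α n ℕ.* M ℕ.+ k)
                (ℕₚ.*-comm (↧ₙ seq α n) (↧ₙ seq α m))
                (near-ℕ (seq α n) (seq α m) M {{M≢0}} (h₂ n m (≥N₂ n≥) (≥N₂ m≥)))))
            (floor-bounded (suc n) u w (num (seq α n)) (↧ₙ seq α n) A
              (bound-ℕ (num (seq α n)) (↧ₙ seq α n) (num (seq α N₁)) (↧ₙ seq α N₁)
                (near-ℕ (seq α n) (seq α N₁) 1 (h₁ n N₁ (≥N₁ n≥) ℕₚ.≤-refl))))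
            (ℕₚ.m≤n⇒m≤1+n (ℕₚ.m⊔n≤o⇒n≤o (N₁ ℕ.⊔ N₂) (2 ℕ.* D) n≥))))
        (ℚₚ.+-monoʳ-≤ (powSeq n) {+ 1 ℚ./ D} {ε} (1/↧≤ 0<ε))

ratioPow : (u w : ℕ) .{{_ : ℕ.NonZero w}} → ℝ → ℝ
ratioPow zero      w α = 0ℝ
ratioPow u@(suc _) w α = mkℝ (powSeq u w α) (powSeq-cauchy u w α)

infixr 8 _^_

-- The real power x^α for x ≥ 0 and α > 0 (so that 0^α = 0); outside this range the
-- value is the junk |x|^|α|.
_^_ : ℚ → ℝ → ℝ
x ^ α = ratioPow (num x) (↧ₙ x) α

fromℕ : ℕ → ℚ
fromℕ k = fromℤ (+ k)

1≤j/N : ∀ j N .{{_ : ℕ.NonZero N}} → N ℕ.≤ j → 1ℚ ℚ.≤ + j ℚ./ N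
1≤j/N j (suc N) h = ℚₚ.toℚᵘ-cancel-≤ (ℚᵘₚ.≤-trans
  (ℚᵘ.*≤* {mkℚᵘ (+ 1) 0} {mkℚᵘ (+ j) N}
    (subst₂ ℤ._≤_ (sym (ℤₚ.*-identityˡ (+ suc N))) (sym (ℤₚ.*-identityʳ (+ j))) (ℤ.+≤+ h)))
  (ℚᵘₚ.≤-reflexive (ℚᵘₚ.≃-sym (ℚₚ.toℚᵘ-fromℚᵘ (mkℚᵘ (+ j) N)))))

suc^-positive : ∀ k α → 0ℝ < fromℕ (suc k) ^ α
suc^-positive k α = 1ℚ , 0<1/ 1 , 0 , λ n _ →
  subst (ℚ._≤ powSeq (suc k) 1 α n) (sym (ℚₚ.+-identityˡ 1ℚ))
    (1≤j/N (powFloor (suc k) 1 α n) (suc n) (suc-n≤ n))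
  where
  open ℕₚ.≤-Reasoning
  suc-n≤ : ∀ n → suc n ℕ.≤ powFloor (suc k) 1 α n
  suc-n≤ n = floor-maximal (suc n) (suc k) 1 a b (suc n) (begin
    suc n ℕ.^ b ℕ.* 1 ℕ.^ a      ≡⟨ cong (suc n ℕ.^ b ℕ.*_) (ℕₚ.^-zeroˡ a) ⟩
    suc n ℕ.^ b ℕ.* 1            ≡⟨ ℕₚ.*-identityʳ (suc n ℕ.^ b) ⟩
    suc n ℕ.^ b                  ≤⟨ ℕₚ.m≤n*m (suc n ℕ.^ b) (suc k ℕ.^ a) {{ℕₚ.m^n≢0 (suc k) a}} ⟩
    suc k ℕ.^ a ℕ.* suc n ℕ.^ b  ∎)
    where
    a = num (seq α n)
    b = ↧ₙ seq α n

infixl 7 _/_[_]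

_/_[_] : (x y : ℝ) → 0ℝ < y → ℝ
x / y [ 0<y ] = x * y ⁻¹[ 0<y ]

∑ : ∀ {n} → (Fin n → ℝ) → ℝ
∑ = foldr _+_ 0ℝ

-- Relations rather than functions, since constructively the infimum over all instances
-- cannot be computed for an arbitrary policy.
IsInfimum : {A : Set} → (A → ℝ) → ℝ → Set
IsInfimum f w = (∀ a → w ≤ f a) × (∀ c → (∀ a → c ≤ f a) → c ≤ w)

IsSupremum : (ℝ → Set) → ℝ → Set
IsSupremum P v = (∀ w → P w → w ≤ v) × (∀ c → (∀ w → P w → w ≤ c) → v ≤ c)

-- Times are Fin n, so t : Fin n stands for the 1-based time suc (toℕ t), and
-- Fin′ (suc t) is the set of times up to and including t.

record Instance (n : ℕ) : Set where
  field
    values : Vec ℕ n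
    best   : Fin n
    unique : ∀ t → t ≢ best → lookup values t ℕ.< lookup values best

open Instance public

-- The probability of a signal at time s when the maximum is at time i.
signalProbability : ∀ {n} → ℝ → (i : Fin n) → Fin′ (Fin.suc i) → ℝ
signalProbability α i s =
  (fromℕ (suc (toℕ s)) ^ α - fromℕ (toℕ s) ^ α) / fromℕ (suc (toℕ i)) ^ α [ suc^-positive (toℕ i) α ]

-- The value of an item, and whether the signal occurs at its arrival.
Observation : Set
Observation = ℕ × Bool

History : ∀ {n} → Fin n → Set
History t = Vec Observation (suc (toℕ t))

history : ∀ {n} → Vec ℕ n → (s t : Fin n) → History t
history v s t = tabulate λ u → let r = inject! {i = Fin.suc t} u in
  lookup v r , does (r Fin.≟ s)

-- true means accept; decisions after the first acceptance have no effect.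
Policy : ℕ → Set
Policy n = (t : Fin n) → History t → Bool

StopsAt : ∀ {n} → Policy n → Vec ℕ n → (s t : Fin n) → Set
StopsAt π v s t =
  T (π t (history v s t)) × (∀ u → u Fin.< t → ¬ T (π u (history v s u)))

stopsAt? : ∀ {n} (π : Policy n) v s t → Dec (StopsAt π v s t)
stopsAt? π v s t =
  T? (π t (history v s t)) ×-dec
  Finₚ.all? (λ u → (u Fin.<? t) →-dec ¬? (T? (π u (history v s u))))

successProbability : ∀ {n} → ℝ → Policy n → Instance n → ℝ
successProbability α π I = ∑ λ (s : Fin′ (Fin.suc (best I))) →
  if does (stopsAt? π (values I) (inject! s) (best I))
  then signalProbability α (best I) s
  else 0ℝ

IsWorstCase : ∀ {n} → ℝ → Policy n → ℝ → Set
IsWorstCase α π w = IsInfimum (successProbability α π) w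

IsOPT : ℝ → ℕ → ℝ → Set
IsOPT α n v = IsSupremum (λ w → ∃ λ (π : Policy n) → IsWorstCase α π w) v

IsOptimal : ∀ {n} → ℝ → Policy n → Set
IsOptimal {n} α π = ∃ λ v → IsOPT α n v × IsWorstCase α π v

Signalled : ∀ {m} → Vec Observation m → Set
Signalled h = Any (T ∘ proj₂) h

-- The item arriving last in the history is strictly better than all items before it.
IsRecord : ∀ {m} → Vec Observation (suc m) → Set
IsRecord h = All (λ o → proj₁ o ℕ.< proj₁ (last h)) (init h)

signalled? : ∀ {m} (h : Vec Observation m) → Dec (Signalled h)
signalled? = Any.any? (T? ∘ proj₂)

isRecord? : ∀ {m} (h : Vec Observation (suc m)) → Dec (IsRecord h)
isRecord? h = All.all? (λ o → proj₁ o ℕ.<? proj₁ (last h)) (init h)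

𝒜 : ∀ {n} → Policy n
𝒜 t h = does (signalled? h ×-dec isRecord? h)

{-# OPTIONS --safe #-}

-- Upper bound: let the values increase up to time i and be 0 afterwards. Before time i
-- this instance looks the same for every later i. Either the policy never wins some of
-- these instances, or, by induction on i, it wins the i-th one upon a signal at time i:
-- signals at earlier times already make it stop earlier. On the fully increasing
-- instance it then wins only if the signal arrives at time n. Conversely, 𝒜 wins
-- whenever the signal arrives at the maximum, which is least likely when the maximum
-- comes last.
--
-- Reals are compared through their n-th rational approximations, up to O(1/n).
module Submission where

open import Defs
open import Data.Bool using (Bool; true; false; T; if_then_else_)
open import Data.Fin as Fin using (Fin; Fin′; toℕ; inject!)
import Data.Fin.Induction as Fin
import Data.Fin.Properties as Finₚ
open import Data.Integer as ℤ using (+_)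
import Data.Integer.Properties as ℤₚ
open import Data.Nat as ℕ using (ℕ; zero; suc)
open import Data.Nat.Coprimality as Coprimality using (Coprime)
import Data.Nat.Properties as ℕₚ
import Data.Nat.Solver as ℕ-Solver
open import Data.Product as Product using (∃; _×_; _,_; proj₁; proj₂)
open import Data.Rational as ℚ using (ℚ; mkℚ; 0ℚ; 1ℚ; ½; ↧ₙ_)
import Data.Rational.Properties as ℚₚ
import Data.Rational.Solver as ℚ-Solver
open import Data.Rational.Unnormalised as ℚᵘ using (mkℚᵘ)
import Data.Rational.Unnormalised.Properties as ℚᵘₚ
open import Data.Vec using (Vec; _∷_; init; last; lookup; tabulate)
import Data.Vec.Properties as Vecₚ
import Data.Vec.Relation.Unary.All as All
import Data.Vec.Relation.Unary.All.Properties as Allₚ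
import Data.Vec.Relation.Unary.Any.Properties as Anyₚ
open import Function using (_∘_)
open import Induction.WellFounded using (Acc; acc)
open import Relation.Binary.PropositionalEquality
open import Relation.Nullary using (Dec; does; yes; no; ¬_; contradiction; _×-dec_)
open import Relation.Nullary.Decidable using (dec-true; dec-false)

-- Fractions with natural numerators

fraction-≤ : ∀ {x y N M} .{{_ : ℕ.NonZero N}} .{{_ : ℕ.NonZero M}} →
             x ℕ.* M ℕ.≤ y ℕ.* N → + x ℚ./ N ℚ.≤ + y ℚ./ M
fraction-≤ {x} {y} {suc N} {suc M} h = ℚₚ.toℚᵘ-cancel-≤ (begin
  ℚ.toℚᵘ (+ x ℚ./ suc N)  ≃⟨ ℚₚ.toℚᵘ-fromℚᵘ (mkℚᵘ (+ x) N) ⟩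
  mkℚᵘ (+ x) N            ≤⟨ ℚᵘ.*≤* (subst₂ ℤ._≤_ (ℤₚ.pos-* x _) (ℤₚ.pos-* y _) (ℤ.+≤+ h)) ⟩
  mkℚᵘ (+ y) M            ≃⟨ ℚₚ.toℚᵘ-fromℚᵘ (mkℚᵘ (+ y) M) ⟨
  ℚ.toℚᵘ (+ y ℚ./ suc M)  ∎)
  where open ℚᵘₚ.≤-Reasoning

fraction-+ : ∀ x y N .{{_ : ℕ.NonZero N}} → + x ℚ./ N ℚ.+ + y ℚ./ N ≡ + (x ℕ.+ y) ℚ./ N
fraction-+ x y (suc N) = ℚₚ.toℚᵘ-injective (begin
  ℚ.toℚᵘ (+ x ℚ./ suc N ℚ.+ + y ℚ./ suc N)
    ≈⟨ ℚₚ.toℚᵘ-homo-+ (+ x ℚ./ suc N) (+ y ℚ./ suc N) ⟩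
  ℚ.toℚᵘ (+ x ℚ./ suc N) ℚᵘ.+ ℚ.toℚᵘ (+ y ℚ./ suc N)
    ≈⟨ ℚᵘₚ.+-cong (ℚₚ.toℚᵘ-fromℚᵘ (mkℚᵘ (+ x) N)) (ℚₚ.toℚᵘ-fromℚᵘ (mkℚᵘ (+ y) N)) ⟩
  mkℚᵘ (+ x) N ℚᵘ.+ mkℚᵘ (+ y) N
    ≈⟨ ℚᵘ.*≡* (trans (cong (ℤ._* d) (sym (ℤₚ.*-distribʳ-+ d (+ x) (+ y)))) (ℤₚ.*-assoc (+ x ℤ.+ + y) d d)) ⟩
  mkℚᵘ (+ (x ℕ.+ y)) N
    ≈⟨ ℚₚ.toℚᵘ-fromℚᵘ (mkℚᵘ (+ (x ℕ.+ y)) N) ⟨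
  ℚ.toℚᵘ (+ (x ℕ.+ y) ℚ./ suc N) ∎)
  where
  open ℚᵘₚ.≃-Reasoning
  d = + suc N

fraction-* : ∀ x y N .{{_ : ℕ.NonZero N}} →
             (+ x ℚ./ N) ℚ.* (+ y ℚ./ N) ≡ (+ (x ℕ.* y) ℚ./ (N ℕ.* N)) {{ℕₚ.m*n≢0 N N}}
fraction-* x y (suc N) = ℚₚ.toℚᵘ-injective (begin
  ℚ.toℚᵘ ((+ x ℚ./ suc N) ℚ.* (+ y ℚ./ suc N))
    ≈⟨ ℚₚ.toℚᵘ-homo-* (+ x ℚ./ suc N) (+ y ℚ./ suc N) ⟩
  ℚ.toℚᵘ (+ x ℚ./ suc N) ℚᵘ.* ℚ.toℚᵘ (+ y ℚ./ suc N)
    ≈⟨ ℚᵘₚ.*-cong (ℚₚ.toℚᵘ-fromℚᵘ (mkℚᵘ (+ x) N)) (ℚₚ.toℚᵘ-fromℚᵘ (mkℚᵘ (+ y) N)) ⟩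
  mkℚᵘ (+ x) N ℚᵘ.* mkℚᵘ (+ y) N
    ≡⟨ cong (λ z → mkℚᵘ z M) (sym (ℤₚ.pos-* x y)) ⟩
  mkℚᵘ (+ (x ℕ.* y)) M
    ≈⟨ ℚₚ.toℚᵘ-fromℚᵘ (mkℚᵘ (+ (x ℕ.* y)) M) ⟨
  ℚ.toℚᵘ (+ (x ℕ.* y) ℚ./ (suc N ℕ.* suc N)) ∎)
  where
  open ℚᵘₚ.≃-Reasoning
  M = ℕ.pred (suc N ℕ.* suc N)

eventually-below : ∀ k ε → 0ℚ ℚ.< ε → ∃ λ N → ∀ n → N ℕ.≤ n → + k ℚ./ suc n ℚ.≤ ε
-- With D the denominator of ε, n ≥ kD gives k/(n+1) ≤ 1/D ≤ ε.
eventually-below k ε 0<ε = k ℕ.* ↧ₙ ε , λ n kD≤n →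
  ℚₚ.≤-trans (fraction-≤ {k} {1} {suc n} {↧ₙ ε}
    (ℕₚ.≤-trans kD≤n (ℕₚ.≤-trans (ℕₚ.n≤1+n n) (ℕₚ.m≤n*m (suc n) 1)))) (1/↧≤ 0<ε)

coprime-suc : ∀ m → Coprime m (suc m)
coprime-suc m = Coprimality.sym
  (subst (λ k → Coprime k m) (ℕₚ.+-comm m 1) (Coprimality.coprime-+ (Coprimality.1-coprimeTo m)))

-- `_^_` is computed from the numerator and denominator in lowest terms, so the base must be
-- identified as m/(m+1) in that form before the power can unfold.
1-1/suc : ∀ m → 1ℚ ℚ.- + 1 ℚ./ suc m ≡ mkℚ (+ m) m (coprime-suc m)
1-1/suc m = begin
  1ℚ ℚ.- + 1 ℚ./ suc m
    ≡⟨ cong (ℚ._- + 1 ℚ./ suc m) (trans (sym q/q≡1) (sym (fraction-+ m 1 (suc m)))) ⟩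
  + m ℚ./ suc m ℚ.+ + 1 ℚ./ suc m ℚ.- + 1 ℚ./ suc m
    ≡⟨ solve 2 (λ x y → x :+ y :- y := x) refl (+ m ℚ./ suc m) (+ 1 ℚ./ suc m) ⟩
  + m ℚ./ suc m
    ≡⟨ ℚₚ.↥p/↧p≡p (mkℚ (+ m) m (coprime-suc m)) ⟩
  mkℚ (+ m) m _ ∎
  where
  open ≡-Reasoning
  open ℚ-Solver.+-*-Solver
  q/q≡1 : + (m ℕ.+ 1) ℚ./ suc m ≡ 1ℚ
  q/q≡1 = ℚₚ.toℚᵘ-injective (ℚᵘₚ.≃-trans (ℚₚ.toℚᵘ-fromℚᵘ (mkℚᵘ (+ (m ℕ.+ 1)) m))
    (ℚᵘ.*≡* (trans (ℤₚ.*-identityʳ _) (trans (cong +_ (ℕₚ.+-comm m 1)) (sym (ℤₚ.*-identityˡ _))))))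

-- Rational approximations of powers

-- Numerator over N+1 of the N-th approximation of (u/w)^α. Base 0 is included, so that increments
-- starting at 0^α need no separate treatment.
ratioFloor : (u w : ℕ) → ℝ → ℕ → ℕ
ratioFloor zero      w α N = 0
ratioFloor u@(suc _) w α N = ⌊ suc N *[ u / w ]^[ num (seq α N) / ↧ₙ seq α N ]⌋

seq-ratioPow : ∀ u w .{{_ : ℕ.NonZero w}} α N → seq (ratioPow u w α) N ≡ + ratioFloor u w α N ℚ./ suc N
seq-ratioPow zero    w α N = sym (ℚₚ.0/n≡0 (suc N))
seq-ratioPow (suc u) w α N = refl

module _ (α : ℝ) (N : ℕ) where

  private
    N′ a b : ℕ
    N′ = suc N
    a = num (seq α N)
    b = ↧ₙ seq α N

    root-≤ : ∀ {x y} → x ℕ.^ b ℕ.≤ y ℕ.^ b → x ℕ.≤ y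
    root-≤ = ^-cancelʳ-≤ b

  ratioFloor-lower : ∀ u w → FloorAtLeast N′ u w a b (ratioFloor u w α N)
  ratioFloor-lower zero    w = ℕ.z≤n
  ratioFloor-lower (suc u) w = floor-lower N′ (suc u) w a b

  -- The base must be nonzero: an approximation of α may have numerator 0, and with 0^0 = 1 the
  -- bound would fail at u = 0.
  ratioFloor-upper : ∀ u w .{{_ : ℕ.NonZero u}} .{{_ : ℕ.NonZero w}} →
                     u ℕ.^ a ℕ.* N′ ℕ.^ b ℕ.≤ suc (ratioFloor u w α N) ℕ.^ b ℕ.* w ℕ.^ a
  ratioFloor-upper (suc u) w = ℕₚ.<⇒≤ (floor-upper N′ (suc u) w a b)

  ratioFloor-mono : ∀ k → ratioFloor k 1 α N ℕ.≤ ratioFloor (suc k) 1 α N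
  ratioFloor-mono k = floor-maximal N′ (suc k) 1 a b _ (ℕₚ.≤-trans (ratioFloor-lower k 1)
    (ℕₚ.*-monoˡ-≤ (N′ ℕ.^ b) (ℕₚ.^-monoˡ-≤ a (ℕₚ.n≤1+n k))))

  -- At base 1 the floor is exact, and it grows with the base. Hence every approximation of (k+1)^α
  -- is at least 1 and can safely be inverted.
  ratioFloor-≥ : ∀ k → N′ ℕ.≤ ratioFloor (suc k) 1 α N
  ratioFloor-≥ zero    = floor-maximal N′ 1 1 a b N′ (ℕₚ.≤-reflexive (ℕₚ.*-comm (N′ ℕ.^ b) (1 ℕ.^ a)))
  ratioFloor-≥ (suc k) = ℕₚ.≤-trans (ratioFloor-≥ k) (ratioFloor-mono (suc k))

  ratioFloor-≤ : ∀ m → ratioFloor m (suc m) α N ℕ.≤ N′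
  ratioFloor-≤ m = root-≤ (ℕₚ.*-cancelʳ-≤ _ _ (suc m ℕ.^ a) {{ℕₚ.m^n≢0 (suc m) a}} (begin
    ratioFloor m (suc m) α N ℕ.^ b ℕ.* suc m ℕ.^ a  ≤⟨ ratioFloor-lower m (suc m) ⟩
    m ℕ.^ a ℕ.* N′ ℕ.^ b      ≤⟨ ℕₚ.*-monoˡ-≤ (N′ ℕ.^ b) (ℕₚ.^-monoˡ-≤ a (ℕₚ.n≤1+n m)) ⟩
    suc m ℕ.^ a ℕ.* N′ ℕ.^ b  ≡⟨ ℕₚ.*-comm (suc m ℕ.^ a) _ ⟩
    N′ ℕ.^ b ℕ.* suc m ℕ.^ a  ∎))
    where open ℕₚ.≤-Reasoning

  -- As N → ∞: k^α ≤ (k+1)^α (m/(m+1))^α.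
  floor-product-≥ : ∀ k m → k ℕ.≤ m → ratioFloor k 1 α N ℕ.* N′ ℕ.≤
                    suc (ratioFloor (suc k) 1 α N) ℕ.* suc (ratioFloor m (suc m) α N)
  floor-product-≥ zero      m         _   = ℕ.z≤n
  -- Raising to the power b and multiplying by W clears the roots and the denominator of m/(m+1).
  floor-product-≥ k@(suc _) m@(suc _) k≤m = root-≤ (ℕₚ.*-cancelʳ-≤ _ _ W {{ℕₚ.m^n≢0 (suc m) a}} (begin
    (j ℕ.* N′) ℕ.^ b ℕ.* W
      ≡⟨ cong (ℕ._* W) (^-distribʳ-* j N′ b) ⟩
    j ℕ.^ b ℕ.* X ℕ.* W
      ≡⟨ solve 3 (λ J X W → J :* X :* W := J :* con 1 :* (X :* W)) refl (j ℕ.^ b) X W ⟩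
    j ℕ.^ b ℕ.* 1 ℕ.* (X ℕ.* W)
      ≡⟨ cong (λ z → j ℕ.^ b ℕ.* z ℕ.* (X ℕ.* W)) (sym (ℕₚ.^-zeroˡ a)) ⟩
    j ℕ.^ b ℕ.* 1 ℕ.^ a ℕ.* (X ℕ.* W)
      ≤⟨ ℕₚ.*-monoˡ-≤ (X ℕ.* W) (ratioFloor-lower k 1) ⟩
    k ℕ.^ a ℕ.* X ℕ.* (X ℕ.* W)
      ≡⟨ solve 3 (λ K X W → K :* X :* (X :* W) := K :* W :* (X :* X)) refl (k ℕ.^ a) X W ⟩
    k ℕ.^ a ℕ.* W ℕ.* (X ℕ.* X)
      ≡⟨ cong (ℕ._* (X ℕ.* X)) (sym (^-distribʳ-* k (suc m) a)) ⟩
    (k ℕ.* suc m) ℕ.^ a ℕ.* (X ℕ.* X)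
      ≤⟨ ℕₚ.*-monoˡ-≤ (X ℕ.* X) (ℕₚ.^-monoˡ-≤ a cross) ⟩
    (suc k ℕ.* m) ℕ.^ a ℕ.* (X ℕ.* X)
      ≡⟨ cong (ℕ._* (X ℕ.* X)) (^-distribʳ-* (suc k) m a) ⟩
    suc k ℕ.^ a ℕ.* m ℕ.^ a ℕ.* (X ℕ.* X)
      ≡⟨ solve 3 (λ K M X → K :* M :* (X :* X) := K :* X :* (M :* X)) refl (suc k ℕ.^ a) (m ℕ.^ a) X ⟩
    (suc k ℕ.^ a ℕ.* X) ℕ.* (m ℕ.^ a ℕ.* X)
      -- Rounding down goes the wrong way only here, which accounts for both successors in the
      -- conclusion.
      ≤⟨ ℕₚ.*-mono-≤ (ratioFloor-upper (suc k) 1) (ratioFloor-upper m (suc m)) ⟩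
    (i ℕ.^ b ℕ.* 1 ℕ.^ a) ℕ.* (c ℕ.^ b ℕ.* W)
      ≡⟨ cong (λ z → (i ℕ.^ b ℕ.* z) ℕ.* (c ℕ.^ b ℕ.* W)) (ℕₚ.^-zeroˡ a) ⟩
    (i ℕ.^ b ℕ.* 1) ℕ.* (c ℕ.^ b ℕ.* W)
      ≡⟨ solve 3 (λ I C W → I :* con 1 :* (C :* W) := I :* C :* W) refl (i ℕ.^ b) (c ℕ.^ b) W ⟩
    i ℕ.^ b ℕ.* c ℕ.^ b ℕ.* W
      ≡⟨ cong (ℕ._* W) (sym (^-distribʳ-* i c b)) ⟩
    (i ℕ.* c) ℕ.^ b ℕ.* W ∎))
    where
    open ℕₚ.≤-Reasoning
    open ℕ-Solver.+-*-Solver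
    X = N′ ℕ.^ b
    W = suc m ℕ.^ a
    j = ratioFloor k 1 α N
    i = suc (ratioFloor (suc k) 1 α N)
    c = suc (ratioFloor m (suc m) α N)
    -- Equivalent to k/(k+1) ≤ m/(m+1).
    cross : k ℕ.* suc m ℕ.≤ suc k ℕ.* m
    cross = ℕₚ.≤-trans (ℕₚ.≤-reflexive (ℕₚ.*-suc k m)) (ℕₚ.+-monoˡ-≤ (k ℕ.* m) k≤m)

  -- As N → ∞: (m/(m+1))^α (m+1)^α ≤ m^α.
  floor-product-≤ : ∀ m → ratioFloor m (suc m) α N ℕ.* ratioFloor (suc m) 1 α N ℕ.≤
                    suc (ratioFloor m 1 α N) ℕ.* N′
  floor-product-≤ zero      = ℕ.z≤n
  floor-product-≤ m@(suc _) = root-≤ (ℕₚ.*-cancelʳ-≤ _ _ W {{ℕₚ.m^n≢0 (suc m) a}} (begin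
    (c ℕ.* i) ℕ.^ b ℕ.* W
      ≡⟨ cong (ℕ._* W) (^-distribʳ-* c i b) ⟩
    c ℕ.^ b ℕ.* i ℕ.^ b ℕ.* W
      ≡⟨ solve 3 (λ C I W → C :* I :* W := C :* W :* (I :* con 1)) refl (c ℕ.^ b) (i ℕ.^ b) W ⟩
    c ℕ.^ b ℕ.* W ℕ.* (i ℕ.^ b ℕ.* 1)
      ≡⟨ cong (λ z → c ℕ.^ b ℕ.* W ℕ.* (i ℕ.^ b ℕ.* z)) (sym (ℕₚ.^-zeroˡ a)) ⟩
    c ℕ.^ b ℕ.* W ℕ.* (i ℕ.^ b ℕ.* 1 ℕ.^ a)
      ≤⟨ ℕₚ.*-mono-≤ (ratioFloor-lower m (suc m)) (ratioFloor-lower (suc m) 1) ⟩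
    m ℕ.^ a ℕ.* X ℕ.* (W ℕ.* X)
      ≤⟨ ℕₚ.*-monoˡ-≤ (W ℕ.* X) (ratioFloor-upper m 1) ⟩
    j ℕ.^ b ℕ.* 1 ℕ.^ a ℕ.* (W ℕ.* X)
      ≡⟨ cong (λ z → j ℕ.^ b ℕ.* z ℕ.* (W ℕ.* X)) (ℕₚ.^-zeroˡ a) ⟩
    j ℕ.^ b ℕ.* 1 ℕ.* (W ℕ.* X)
      ≡⟨ solve 3 (λ J W X → J :* con 1 :* (W :* X) := J :* X :* W) refl (j ℕ.^ b) W X ⟩
    j ℕ.^ b ℕ.* X ℕ.* W
      ≡⟨ cong (ℕ._* W) (sym (^-distribʳ-* j N′ b)) ⟩
    (j ℕ.* N′) ℕ.^ b ℕ.* W ∎))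
    where
    open ℕₚ.≤-Reasoning
    open ℕ-Solver.+-*-Solver
    X = N′ ℕ.^ b
    W = suc m ℕ.^ a
    j = suc (ratioFloor m 1 α N)
    i = ratioFloor (suc m) 1 α N
    c = ratioFloor m (suc m) α N

-- Perturbed quotients of rationals

0≤inverse : ∀ {p} → 0ℚ ℚ.< p → 0ℚ ℚ.≤ inverse p
0≤inverse {p} 0<p with p ℚ.≟ 0ℚ
... | yes _  = ℚₚ.≤-refl
... | no p≢0 = ℚₚ.<⇒≤ (ℚₚ.positive⁻¹ ((ℚ.1/ p) {{ℚ.≢-nonZero p≢0}}) {{ℚₚ.1/pos⇒pos p {{ℚ.positive 0<p}}}})

*-monoʳ : ∀ {p q r} → 0ℚ ℚ.≤ r → p ℚ.≤ q → p ℚ.* r ℚ.≤ q ℚ.* r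
*-monoʳ {r = r} 0≤r = ℚₚ.*-monoʳ-≤-nonNeg r {{ℚ.nonNegative 0≤r}}

module _ {A B C ρ : ℚ} (1≤A : 1ℚ ℚ.≤ A) (0≤ρ : 0ℚ ℚ.≤ ρ) where

  private
    I = inverse A
    0<A : 0ℚ ℚ.< A
    0<A = ℚₚ.<-≤-trans (0<1/ 1) 1≤A
    0≤I : 0ℚ ℚ.≤ I
    0≤I = 0≤inverse 0<A
    IA≡1 : I ℚ.* A ≡ 1ℚ
    IA≡1 = inverse-*ˡ A 0<A

  -- Meant for approximations A, B, C of (k+1)^α, k^α, (m/(m+1))^α with rounding error ρ. Since C ≤
  -- 1 ≤ A and ρ ≤ 1 ≤ A, each of the error terms Aρ, Cρ and ρρ is at most Aρ, and division by A
  -- leaves three times ρ.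
  quotient-≥ : ρ ℚ.≤ 1ℚ → C ℚ.≤ 1ℚ → B ℚ.≤ (A ℚ.+ ρ) ℚ.* (C ℚ.+ ρ) →
               1ℚ ℚ.- C ℚ.≤ (A ℚ.- B) ℚ.* I ℚ.+ (ρ ℚ.+ ρ ℚ.+ ρ)
  quotient-≥ ρ≤1 C≤1 B≤ = begin
    1ℚ ℚ.- C
      ≡⟨ ℚₚ.*-identityʳ (1ℚ ℚ.- C) ⟨
    (1ℚ ℚ.- C) ℚ.* 1ℚ
      ≡⟨ cong ((1ℚ ℚ.- C) ℚ.*_) (sym IA≡1) ⟩
    (1ℚ ℚ.- C) ℚ.* (I ℚ.* A)
      ≡⟨ solve 5 (λ A B C ρ I → (con 1ℚ :- C) :* (I :* A)
           := (A :- B :- (A :* C) :+ B) :* I) refl A B C ρ I ⟩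
    (A ℚ.- B ℚ.- A ℚ.* C ℚ.+ B) ℚ.* I
      ≤⟨ *-monoʳ 0≤I (ℚₚ.+-monoʳ-≤ (A ℚ.- B ℚ.- A ℚ.* C) (ℚₚ.≤-trans B≤ product≤)) ⟩
    (A ℚ.- B ℚ.- A ℚ.* C ℚ.+ (A ℚ.* C ℚ.+ (A ℚ.* ρ ℚ.+ A ℚ.* ρ ℚ.+ A ℚ.* ρ))) ℚ.* I
      ≡⟨ solve 5 (λ A B C ρ I → (A :- B :- A :* C :+ (A :* C :+ (A :* ρ :+ A :* ρ :+ A :* ρ))) :* I
           := (A :- B) :* I :+ (I :* A) :* (ρ :+ ρ :+ ρ)) refl A B C ρ I ⟩
    (A ℚ.- B) ℚ.* I ℚ.+ (I ℚ.* A) ℚ.* (ρ ℚ.+ ρ ℚ.+ ρ)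
      ≡⟨ cong ((A ℚ.- B) ℚ.* I ℚ.+_) (trans (cong (ℚ._* (ρ ℚ.+ ρ ℚ.+ ρ)) IA≡1) (ℚₚ.*-identityˡ _)) ⟩
    (A ℚ.- B) ℚ.* I ℚ.+ (ρ ℚ.+ ρ ℚ.+ ρ) ∎
    where
    open ℚₚ.≤-Reasoning
    open ℚ-Solver.+-*-Solver
    product≤ : (A ℚ.+ ρ) ℚ.* (C ℚ.+ ρ) ℚ.≤ A ℚ.* C ℚ.+ (A ℚ.* ρ ℚ.+ A ℚ.* ρ ℚ.+ A ℚ.* ρ)
    product≤ = begin
      (A ℚ.+ ρ) ℚ.* (C ℚ.+ ρ)
        ≡⟨ solve 3 (λ A C ρ → (A :+ ρ) :* (C :+ ρ) := A :* C :+ (A :* ρ :+ C :* ρ :+ ρ :* ρ)) refl A C ρ ⟩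
      A ℚ.* C ℚ.+ (A ℚ.* ρ ℚ.+ C ℚ.* ρ ℚ.+ ρ ℚ.* ρ)
        ≤⟨ ℚₚ.+-monoʳ-≤ (A ℚ.* C) (ℚₚ.+-mono-≤ (ℚₚ.+-monoʳ-≤ (A ℚ.* ρ) (*-monoʳ 0≤ρ (ℚₚ.≤-trans C≤1 1≤A)))
             (*-monoʳ 0≤ρ (ℚₚ.≤-trans ρ≤1 1≤A))) ⟩
      A ℚ.* C ℚ.+ (A ℚ.* ρ ℚ.+ A ℚ.* ρ ℚ.+ A ℚ.* ρ) ∎

  -- Because A ≥ 1, the error ρ is at most Aρ, which division by A turns back into ρ.
  quotient-≤ : C ℚ.* A ℚ.≤ B ℚ.+ ρ → (A ℚ.- B) ℚ.* I ℚ.≤ 1ℚ ℚ.- C ℚ.+ ρ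
  quotient-≤ CA≤ = begin
    (A ℚ.- B) ℚ.* I
      ≡⟨ solve 4 (λ A B C I → (A :- B) :* I := (A :- B :- C :* A :+ C :* A) :* I) refl A B C I ⟩
    (A ℚ.- B ℚ.- C ℚ.* A ℚ.+ C ℚ.* A) ℚ.* I
      ≤⟨ *-monoʳ 0≤I (ℚₚ.+-monoʳ-≤ (A ℚ.- B ℚ.- C ℚ.* A) (ℚₚ.≤-trans CA≤ (ℚₚ.+-monoʳ-≤ B ρ≤ρA))) ⟩
    (A ℚ.- B ℚ.- C ℚ.* A ℚ.+ (B ℚ.+ A ℚ.* ρ)) ℚ.* I
      ≡⟨ solve 5 (λ A B C ρ I → (A :- B :- C :* A :+ (B :+ A :* ρ)) :* I
           := (con 1ℚ :- C :+ ρ) :* (I :* A)) refl A B C ρ I ⟩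
    (1ℚ ℚ.- C ℚ.+ ρ) ℚ.* (I ℚ.* A)
      ≡⟨ trans (cong ((1ℚ ℚ.- C ℚ.+ ρ) ℚ.*_) IA≡1) (ℚₚ.*-identityʳ _) ⟩
    1ℚ ℚ.- C ℚ.+ ρ ∎
    where
    open ℚₚ.≤-Reasoning
    open ℚ-Solver.+-*-Solver
    ρ≤ρA : ρ ℚ.≤ A ℚ.* ρ
    ρ≤ρA = ℚₚ.≤-trans (ℚₚ.≤-reflexive (sym (ℚₚ.*-identityˡ ρ))) (*-monoʳ 0≤ρ 1≤A)

-- The optimal value and the coincidence probability

-- The parameter is m = n - 1, so the base of the power is m/(m+1).
optimum : ℝ → ℕ → ℝ
optimum α m = 1ℝ - (1ℚ ℚ.- + 1 ℚ./ suc m) ^ α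

-- The probability that the signal arrives together with the maximum at time k+1.
coincidence : ℝ → ℕ → ℝ
coincidence α k = (fromℕ (suc k) ^ α - fromℕ k ^ α) / fromℕ (suc k) ^ α [ suc^-positive k α ]

private
  frac : ℕ → ℕ → ℚ
  frac N j = + j ℚ./ suc N

seq-optimum : ∀ α m N → seq (optimum α m) N ≡ 1ℚ ℚ.- frac N (ratioFloor m (suc m) α N)
seq-optimum α m N = cong (λ C → 1ℚ ℚ.- C)
  (trans (cong (λ q → seq (q ^ α) N) (1-1/suc m)) (seq-ratioPow m (suc m) α N))

seq-coincidence : ∀ α k N → let A = frac N (ratioFloor (suc k) 1 α N) in
  seq (coincidence α k) N ≡ (A ℚ.- frac N (ratioFloor k 1 α N)) ℚ.* inverse A
seq-coincidence α k N = cong (λ B → (A ℚ.- B) ℚ.* inverse A) (seq-ratioPow k 1 α N)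
  where A = frac N (ratioFloor (suc k) 1 α N)

module _ (α : ℝ) (k N : ℕ) where
  private
    N′ a b : ℕ
    N′ = suc N
    a = ratioFloor (suc k) 1 α N
    b = ratioFloor k 1 α N
    ρ A B : ℚ
    ρ = frac N 1
    A = frac N a
    B = frac N b
    0≤ρ : 0ℚ ℚ.≤ ρ
    0≤ρ = ℚₚ.<⇒≤ (0<1/ N′)
    1≤A : 1ℚ ℚ.≤ A
    1≤A = 1≤j/N a N′ (ratioFloor-≥ α N k)
    ≤1 : ∀ {j} → j ℕ.≤ N′ → frac N j ℚ.≤ 1ℚ
    ≤1 {j} h = fraction-≤ {j} {1} {N′} {1} (subst₂ ℕ._≤_ (sym (ℕₚ.*-identityʳ j)) (sym (ℕₚ.*-identityˡ N′)) h)

  optimum≤coincidence+ : ∀ {m} → k ℕ.≤ m → seq (optimum α m) N ℚ.≤ seq (coincidence α k) N ℚ.+ frac N 3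
  optimum≤coincidence+ {m} k≤m = subst₂ ℚ._≤_ (sym (seq-optimum α m N))
    (cong₂ ℚ._+_ (sym (seq-coincidence α k N))
      (trans (cong (ℚ._+ ρ) (fraction-+ 1 1 N′)) (fraction-+ 2 1 N′)))
    (quotient-≥ {A} {B} {frac N c} {ρ} 1≤A 0≤ρ (≤1 (ℕ.s≤s ℕ.z≤n)) (≤1 (ratioFloor-≤ α N m)) (begin
      B
        ≤⟨ fraction-≤ {b} {suc a ℕ.* suc c} {N′} {N′ ℕ.* N′} (ℕₚ.≤-trans (ℕₚ.≤-reflexive (sym (ℕₚ.*-assoc b N′ N′)))
             (ℕₚ.*-monoˡ-≤ N′ (floor-product-≥ α N k m k≤m))) ⟩
      (+ (suc a ℕ.* suc c) ℚ./ (N′ ℕ.* N′))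
        ≡⟨ fraction-* (suc a) (suc c) N′ ⟨
      frac N (suc a) ℚ.* frac N (suc c)
        ≡⟨ cong₂ ℚ._*_ (frac-suc a) (frac-suc c) ⟩
      (A ℚ.+ ρ) ℚ.* (frac N c ℚ.+ ρ) ∎))
    where
    open ℚₚ.≤-Reasoning
    c = ratioFloor m (suc m) α N
    frac-suc : ∀ j → frac N (suc j) ≡ frac N j ℚ.+ ρ
    frac-suc j = trans (cong (frac N) (ℕₚ.+-comm 1 j)) (sym (fraction-+ j 1 N′))

  coincidence≤optimum+ : seq (coincidence α k) N ℚ.≤ seq (optimum α k) N ℚ.+ ρ
  coincidence≤optimum+ = subst₂ ℚ._≤_ (sym (seq-coincidence α k N)) (cong (ℚ._+ ρ) (sym (seq-optimum α k N)))
    (quotient-≤ {A} {B} {frac N c} {ρ} 1≤A 0≤ρ (begin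
      frac N c ℚ.* A
        ≡⟨ fraction-* c a N′ ⟩
      (+ (c ℕ.* a) ℚ./ (N′ ℕ.* N′))
        ≤⟨ fraction-≤ {c ℕ.* a} {suc b} {N′ ℕ.* N′} {N′} (ℕₚ.≤-trans (ℕₚ.*-monoˡ-≤ N′ (floor-product-≤ α N k))
             (ℕₚ.≤-reflexive (ℕₚ.*-assoc (suc b) N′ N′))) ⟩
      frac N (suc b)
        ≡⟨ trans (cong (frac N) (ℕₚ.+-comm 1 b)) (sym (fraction-+ b 1 N′)) ⟩
      B ℚ.+ ρ ∎))
    where
    open ℚₚ.≤-Reasoning
    c = ratioFloor k (suc k) α N

  0≤optimum : 0ℚ ℚ.≤ seq (optimum α k) N
  0≤optimum = subst₂ ℚ._≤_ (ℚₚ.+-inverseʳ C) (sym (seq-optimum α k N))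
    (ℚₚ.+-monoˡ-≤ (ℚ.- C) (≤1 (ratioFloor-≤ α N k)))
    where C = frac N (ratioFloor k (suc k) α N)

-- Rounding preserves monotonicity in the base, so signal weights are nonnegative in every
-- approximation and not merely in the limit.
0≤increment : ∀ α k l N →
  0ℚ ℚ.≤ seq ((fromℕ (suc k) ^ α - fromℕ k ^ α) / fromℕ (suc l) ^ α [ suc^-positive l α ]) N
0≤increment α k l N = subst (ℚ._≤ (A ℚ.- seq (fromℕ k ^ α) N) ℚ.* inverse D) (ℚₚ.*-zeroˡ (inverse D))
  (*-monoʳ (0≤inverse (ℚₚ.<-≤-trans (0<1/ 1) (1≤j/N (ratioFloor (suc l) 1 α N) (suc N) (ratioFloor-≥ α N l))))
    (subst₂ ℚ._≤_ (ℚₚ.+-inverseʳ B) (cong (λ q → A ℚ.- q) (sym (seq-ratioPow k 1 α N)))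
      (ℚₚ.+-monoˡ-≤ (ℚ.- B) (fraction-≤ {ratioFloor k 1 α N} {ratioFloor (suc k) 1 α N}
        (ℕₚ.*-monoˡ-≤ (suc N) (ratioFloor-mono α N k))))))
  where
  A B D : ℚ
  A = frac N (ratioFloor (suc k) 1 α N)
  B = frac N (ratioFloor k 1 α N)
  D = frac N (ratioFloor (suc l) 1 α N)

-- Comparing reals

≤-trans : ∀ {x y z} → x ≤ y → y ≤ z → x ≤ z
≤-trans {x} {y} {z} x≤y y≤z ε 0<ε with x≤y (½ ℚ.* ε) (0<½ε ε 0<ε) | y≤z (½ ℚ.* ε) (0<½ε ε 0<ε)
... | N , h | M , k = N ℕ.⊔ M , λ n n≥ → begin
  seq x n                                ≤⟨ h n (ℕₚ.m⊔n≤o⇒m≤o N M n≥) ⟩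
  seq y n ℚ.+ ½ ℚ.* ε                    ≤⟨ ℚₚ.+-monoˡ-≤ (½ ℚ.* ε) (k n (ℕₚ.m⊔n≤o⇒n≤o N M n≥)) ⟩
  seq z n ℚ.+ ½ ℚ.* ε ℚ.+ ½ ℚ.* ε        ≡⟨ ℚₚ.+-assoc (seq z n) (½ ℚ.* ε) (½ ℚ.* ε) ⟩
  seq z n ℚ.+ (½ ℚ.* ε ℚ.+ ½ ℚ.* ε)      ≡⟨ cong (seq z n ℚ.+_) (½+½ ε) ⟩
  seq z n ℚ.+ ε                          ∎
  where open ℚₚ.≤-Reasoning

infix 4 _≼_

-- Comparison at every index without any error, so that sums can be compared term by term with no ε
-- to distribute.
_≼_ : ℝ → ℝ → Set
x ≼ y = ∀ n → seq x n ℚ.≤ seq y n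

≼⇒≤ : ∀ {x y} → x ≼ y → x ≤ y
≼⇒≤ {x} {y} h ε 0<ε = 0 , λ n _ → ℚₚ.≤-trans (h n)
  (subst (ℚ._≤ seq y n ℚ.+ ε) (ℚₚ.+-identityʳ (seq y n)) (ℚₚ.+-monoʳ-≤ (seq y n) (ℚₚ.<⇒≤ 0<ε)))

≤-up-to-O[1/n] : ∀ x y c → (∀ n → seq x n ℚ.≤ seq y n ℚ.+ + c ℚ./ suc n) → x ≤ y
≤-up-to-O[1/n] x y c h ε 0<ε =
  let N , k = eventually-below c ε 0<ε
  in N , λ n n≥ → ℚₚ.≤-trans (h n) (ℚₚ.+-monoʳ-≤ (seq y n) {+ c ℚ./ suc n} {ε} (k n n≥))

-- In the limit `coincidence α k` is 1 - (k/(k+1))^α, which decreases in k: the last time is the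
-- least favourable.
optimum≤coincidence : ∀ α {k m} → k ℕ.≤ m → optimum α m ≤ coincidence α k
optimum≤coincidence α {k} {m} k≤m =
  ≤-up-to-O[1/n] (optimum α m) (coincidence α k) 3 λ N → optimum≤coincidence+ α k N k≤m

-- With the preceding bound at k = m, the two values agree at the last time.
coincidence≤optimum : ∀ α m → coincidence α m ≤ optimum α m
coincidence≤optimum α m = ≤-up-to-O[1/n] (coincidence α m) (optimum α m) 1 (coincidence≤optimum+ α m)

-- Finite sums

0≤∑ : ∀ {n} (f : Fin n → ℝ) → (∀ i → 0ℝ ≼ f i) → 0ℝ ≼ ∑ f
0≤∑ {zero}  f 0≤f N = ℚₚ.≤-refl
0≤∑ {suc n} f 0≤f N = ℚₚ.+-mono-≤ (0≤f Fin.zero N) (0≤∑ (f ∘ Fin.suc) (0≤f ∘ Fin.suc) N)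

∑≼0 : ∀ {n} (f : Fin n → ℝ) → (∀ i → f i ≼ 0ℝ) → ∑ f ≼ 0ℝ
∑≼0 {zero}  f f≤0 N = ℚₚ.≤-refl
∑≼0 {suc n} f f≤0 N = ℚₚ.+-mono-≤ (f≤0 Fin.zero N) (∑≼0 (f ∘ Fin.suc) (f≤0 ∘ Fin.suc) N)

term≼∑ : ∀ {n} (f : Fin n → ℝ) → (∀ i → 0ℝ ≼ f i) → ∀ i → f i ≼ ∑ f
term≼∑ f 0≤f Fin.zero    N = subst (ℚ._≤ seq (∑ f) N) (ℚₚ.+-identityʳ _)
  (ℚₚ.+-monoʳ-≤ (seq (f Fin.zero) N) (0≤∑ (f ∘ Fin.suc) (0≤f ∘ Fin.suc) N))
term≼∑ f 0≤f (Fin.suc i) N = subst (ℚ._≤ seq (∑ f) N) (ℚₚ.+-identityˡ _)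
  (ℚₚ.+-mono-≤ (0≤f Fin.zero N) (term≼∑ (f ∘ Fin.suc) (0≤f ∘ Fin.suc) i N))

∑≼term : ∀ {n} (f : Fin n → ℝ) i → (∀ j → j ≢ i → f j ≼ 0ℝ) → ∑ f ≼ f i
∑≼term f Fin.zero    f≤0 N = subst (seq (∑ f) N ℚ.≤_) (ℚₚ.+-identityʳ _)
  (ℚₚ.+-monoʳ-≤ (seq (f Fin.zero) N) (∑≼0 (f ∘ Fin.suc) (λ j → f≤0 (Fin.suc j) λ ()) N))
∑≼term f (Fin.suc i) f≤0 N = subst (seq (∑ f) N ℚ.≤_) (ℚₚ.+-identityˡ _)
  (ℚₚ.+-mono-≤ (f≤0 Fin.zero (λ ()) N)
    (∑≼term (f ∘ Fin.suc) i (λ j j≢i → f≤0 (Fin.suc j) (j≢i ∘ Finₚ.suc-injective)) N))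

-- Times up to and including a given time

toℕ-inject! : ∀ {n} {i : Fin (suc n)} (j : Fin′ i) → toℕ (inject! j) ≡ toℕ j
toℕ-inject! {suc _} {Fin.suc _} Fin.zero    = refl
toℕ-inject! {suc _} {Fin.suc _} (Fin.suc j) = cong suc (toℕ-inject! j)

inject!-≤ : ∀ {n} {t : Fin n} (s : Fin′ (Fin.suc t)) → inject! s Fin.≤ t
inject!-≤ s = ℕ.s≤s⁻¹ (Finₚ.inject!-< s)

-- The time t itself, seen as the last of the times in its own history.
final : ∀ {n} (t : Fin n) → Fin′ (Fin.suc t)
final t = Fin.fromℕ (toℕ t)

inject!-final : ∀ {n} (t : Fin n) → inject! (final t) ≡ t
inject!-final t = Finₚ.toℕ-injective (trans (toℕ-inject! (final t)) (Finₚ.toℕ-fromℕ (toℕ t)))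

inject!-≢ : ∀ {n} {t : Fin n} {s : Fin′ (Fin.suc t)} → s ≢ final t → inject! s ≢ t
inject!-≢ {t = t} s≢ eq = s≢ (Finₚ.inject!-injective (trans eq (sym (inject!-final t))))

-- Success probabilities

signalProbability-final : ∀ {n} α (t : Fin n) N →
  seq (signalProbability α t (final t)) N ≡ seq (coincidence α (toℕ t)) N
signalProbability-final α t N = cong
  (λ k → (seq (fromℕ (suc k) ^ α) N ℚ.- seq (fromℕ k ^ α) N) ℚ.* inverse (seq (fromℕ (suc (toℕ t)) ^ α) N))
  (Finₚ.toℕ-fromℕ (toℕ t))

0≼signalProbability : ∀ {n} α (t : Fin n) s → 0ℝ ≼ signalProbability α t s
0≼signalProbability α t s N = 0≤increment α (toℕ s) (toℕ t) N

module _ {n} (b : Fin n → Bool) (p : Fin n → ℝ) where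

  private
    filtered : Fin n → ℝ
    filtered s = if b s then p s else 0ℝ

    0≼filtered : (∀ s → 0ℝ ≼ p s) → ∀ s → 0ℝ ≼ filtered s
    0≼filtered 0≼p s with b s
    ... | true  = 0≼p s
    ... | false = λ _ → ℚₚ.≤-refl

    filtered≼0 : ∀ s → b s ≡ false → filtered s ≼ 0ℝ
    filtered≼0 s bs≡false N rewrite bs≡false = ℚₚ.≤-refl

  p≼∑-filtered : (∀ s → 0ℝ ≼ p s) → ∀ t → b t ≡ true → p t ≼ ∑ λ s → if b s then p s else 0ℝ
  p≼∑-filtered 0≼p t bt≡true N = ℚₚ.≤-trans p≤ (term≼∑ filtered (0≼filtered 0≼p) t N)
    where
    p≤ : seq (p t) N ℚ.≤ seq (filtered t) N
    p≤ rewrite bt≡true = ℚₚ.≤-refl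

  -- Nothing is known about `b t`: the only remaining term is `p t` or 0, and nonnegativity covers
  -- the second case.
  ∑-filtered≼p : (∀ s → 0ℝ ≼ p s) → ∀ t → (∀ s → s ≢ t → b s ≡ false) → (∑ λ s → if b s then p s else 0ℝ) ≼ p t
  ∑-filtered≼p 0≼p t elsewhere N = ℚₚ.≤-trans (∑≼term filtered t (λ s s≢t → filtered≼0 s (elsewhere s s≢t)) N) ≤p
    where
    ≤p : seq (filtered t) N ℚ.≤ seq (p t) N
    ≤p with b t
    ... | true  = ℚₚ.≤-refl
    ... | false = 0≼p t N

  ∑-filtered≼0 : (∀ s → b s ≡ false) → (∑ λ s → if b s then p s else 0ℝ) ≼ 0ℝ
  ∑-filtered≼0 nowhere = ∑≼0 filtered λ s → filtered≼0 s (nowhere s)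

module _ {n} (α : ℝ) (π : Policy n) (I : Instance n) where

  -- All terms of the sum are nonnegative, so a win upon a signal at the maximum already contributes
  -- its full weight.
  success-≽ : StopsAt π (values I) (best I) (best I) →
              signalProbability α (best I) (final (best I)) ≼ successProbability α π I
  success-≽ stops = p≼∑-filtered
    (λ s → does (stopsAt? π (values I) (inject! s) (best I))) (signalProbability α (best I))
    (0≼signalProbability α (best I)) (final (best I))
    (dec-true (stopsAt? π (values I) (inject! (final (best I))) (best I))
      (subst (λ s → StopsAt π (values I) s (best I)) (sym (inject!-final (best I))) stops))

  -- Signals never come after the maximum; once the earlier ones are lost, only the final term can
  -- remain.
  success-≼ : (∀ s → s Fin.< best I → ¬ StopsAt π (values I) s (best I)) →
              successProbability α π I ≼ signalProbability α (best I) (final (best I))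
  success-≼ misses = ∑-filtered≼p
    (λ s → does (stopsAt? π (values I) (inject! s) (best I))) (signalProbability α (best I))
    (0≼signalProbability α (best I)) (final (best I))
    (λ s s≢ → dec-false (stopsAt? π (values I) (inject! s) (best I))
      (misses (inject! s) (Finₚ.≤∧≢⇒< (inject!-≤ s) (inject!-≢ s≢))))

  success-≼0 : (∀ s → ¬ StopsAt π (values I) (inject! {i = Fin.suc (best I)} s) (best I)) →
               successProbability α π I ≼ 0ℝ
  success-≼0 misses = ∑-filtered≼0
    (λ s → does (stopsAt? π (values I) (inject! s) (best I))) (signalProbability α (best I))
    (λ s → dec-false (stopsAt? π (values I) (inject! s) (best I)) (misses s))

-- The policy 𝒜

last-tabulate : ∀ {A : Set} {m} (f : Fin (suc m) → A) → last (tabulate f) ≡ f (Fin.fromℕ m)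
last-tabulate {m = zero}  f = refl
last-tabulate {m = suc m} f = last-tabulate (f ∘ Fin.suc)

init-tabulate : ∀ {A : Set} {m} (f : Fin (suc m) → A) → init (tabulate f) ≡ tabulate (f ∘ Fin.inject₁)
init-tabulate {m = zero}  f = refl
init-tabulate {m = suc m} f = cong (f Fin.zero ∷_) (init-tabulate (f ∘ Fin.suc))

module _ {n} (I : Instance n) where

  private
    v : Vec ℕ n
    v = values I
    i : Fin n
    i = best I
    observation : (t : Fin n) → Fin′ (Fin.suc t) → Observation
    observation t u = lookup v (inject! u) , does (inject! {i = Fin.suc t} u Fin.≟ i)

  signalled-at-best : Signalled (history v i i)
  signalled-at-best = Anyₚ.tabulate⁺ {f = observation i} (final i)
    (subst T (sym (dec-true (inject! (final i) Fin.≟ i) (inject!-final i))) _)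

  unsignalled-before-best : ∀ {t} → t Fin.< i → ¬ Signalled (history v i t)
  unsignalled-before-best {t} t<i sig with Anyₚ.tabulate⁻ {f = observation t} sig
  ... | u , signal = subst T (dec-false (inject! u Fin.≟ i) u≢i) signal
    where
    u≢i : inject! u ≢ i
    u≢i eq = ℕₚ.<⇒≱ t<i (subst (Fin._≤ t) eq (inject!-≤ u))

  record-at-best : IsRecord (history v i i)
  record-at-best = subst₂ (λ os o → All.All (λ o′ → proj₁ o′ ℕ.< proj₁ o) os)
    (sym (init-tabulate (observation i))) (sym (last-tabulate (observation i))) (Allₚ.tabulate⁺ below)
    where
    below : ∀ j → proj₁ (observation i (Fin.inject₁ j)) ℕ.< proj₁ (observation i (final i))
    below j = subst (λ k → lookup v (inject! (Fin.inject₁ j)) ℕ.< lookup v k) (sym (inject!-final i))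
      (unique I (inject! (Fin.inject₁ j)) (inject!-≢ {s = Fin.inject₁ j} (Finₚ.fromℕ≢inject₁ ∘ sym)))

  -- Before time i no signal has been seen, so nothing is accepted. At time i the signal is present,
  -- and the unique maximum is a strict record.
  𝒜-stops-at-best : StopsAt 𝒜 v i i
  𝒜-stops-at-best =
    subst T (sym (dec-true (signalled? (history v i i) ×-dec isRecord? (history v i i))
      (signalled-at-best , record-at-best))) _ ,
    λ t t<i → subst T (dec-false (signalled? (history v i t) ×-dec isRecord? (history v i t))
      (unsignalled-before-best t<i ∘ proj₁))

-- The increasing instances

-- Heights start at 1, so the trailing zeros stay strictly below the peak even when the peak is at
-- the first time.
rampHeight : ∀ {n} → Fin n → Fin n → ℕ
rampHeight i t with t Fin.≤? i
... | yes _ = suc (toℕ t)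
... | no  _ = 0

rampHeight-≤ : ∀ {n} {i t : Fin n} → t Fin.≤ i → rampHeight i t ≡ suc (toℕ t)
rampHeight-≤ {i = i} {t} t≤i with t Fin.≤? i
... | yes _  = refl
... | no t≰i = contradiction t≤i t≰i

rampHeight-< : ∀ {n} {i t : Fin n} → t ≢ i → rampHeight i t ℕ.< suc (toℕ i)
rampHeight-< {i = i} {t} t≢i with t Fin.≤? i
... | yes t≤i = ℕ.s≤s (Finₚ.≤∧≢⇒< t≤i t≢i)
... | no  _   = ℕ.s≤s ℕ.z≤n

ramp : ∀ {n} → Fin n → Instance n
values (ramp i) = tabulate (rampHeight i)
best   (ramp i) = i
unique (ramp i) t t≢i = subst₂ ℕ._<_ (sym (Vecₚ.lookup∘tabulate (rampHeight i) t))
  (sym (trans (Vecₚ.lookup∘tabulate (rampHeight i) i) (rampHeight-≤ {i = i} ℕₚ.≤-refl)))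
  (rampHeight-< t≢i)

-- All times up to t lie on the increasing part of both ramps.
ramp-history : ∀ {n} {i t : Fin n} s → t Fin.≤ i →
               history (values (ramp i)) s t ≡ history (values (ramp t)) s t
ramp-history {i = i} {t} s t≤i = Vecₚ.tabulate-cong λ u → cong (_, does (inject! u Fin.≟ s)) (begin
  lookup (values (ramp i)) (inject! u)  ≡⟨ Vecₚ.lookup∘tabulate (rampHeight i) (inject! u) ⟩
  rampHeight i (inject! u)
    ≡⟨ rampHeight-≤ {t = inject! u} (ℕₚ.≤-trans (inject!-≤ u) t≤i) ⟩
  suc (toℕ (inject! u))                 ≡⟨ rampHeight-≤ {t = inject! u} (inject!-≤ u) ⟨
  rampHeight t (inject! u)              ≡⟨ Vecₚ.lookup∘tabulate (rampHeight t) (inject! u) ⟨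
  lookup (values (ramp t)) (inject! u)  ∎)
  where open ≡-Reasoning

-- Deterministic policies on the ramps

module _ {n} (π : Policy n) where

  -- The ramp peaking at t serves as representative: by `ramp-history`, every ramp with a later peak
  -- gives the same behaviour through time t.
  Stops : (s t : Fin n) → Set
  Stops s t = StopsAt π (values (ramp t)) s t

  Wins : Fin n → Set
  Wins i = ∃ λ (s : Fin′ (Fin.suc i)) → Stops (inject! s) i

  wins? : ∀ i → Dec (Wins i)
  wins? i = Finₚ.any? λ s → stopsAt? π (values (ramp i)) (inject! s) i

  -- The ramps with peaks s and i look alike up to time s, so on the later one the policy has
  -- already accepted at time s.
  stops-once : ∀ {s i} → s Fin.< i → Stops s s → ¬ Stops s i
  stops-once {s} s<i (stop , _) (_ , wait) =
    wait s s<i (subst (T ∘ π s) (sym (ramp-history s (ℕₚ.<⇒≤ s<i))) stop)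

  stops-at-signal : (∀ i → Wins i) → ∀ i → Stops i i
  stops-at-signal wins i = go i (Fin.<-wellFounded i)
    where
    go : ∀ i → Acc Fin._<_ i → Stops i i
    go i (acc rec) with wins i
    ... | s , stops with inject! s Fin.≟ i
    ...   | yes eq = subst (λ r → Stops r i) eq stops
    -- An earlier winning signal is impossible: by the induction hypothesis it already makes the
    -- policy stop at the signal.
    ...   | no  ≢i = contradiction stops (stops-once s<i (go (inject! s) (rec s<i)))
      where s<i = Finₚ.≤∧≢⇒< (inject!-≤ s) ≢i

-- The two bounds and optimality

𝒜-guarantee : ∀ α {m} (I : Instance (suc m)) → optimum α m ≤ successProbability α 𝒜 I
𝒜-guarantee α {m} I =
  ≤-trans {optimum α m} {coincidence α (toℕ (best I))} {successProbability α 𝒜 I}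
    (optimum≤coincidence α (Finₚ.toℕ≤pred[n] (best I)))
    (≤-trans {coincidence α (toℕ (best I))} {p} {successProbability α 𝒜 I}
      (≼⇒≤ {coincidence α (toℕ (best I))} {p}
        (λ N → ℚₚ.≤-reflexive (sym (signalProbability-final α (best I) N))))
      (≼⇒≤ {p} {successProbability α 𝒜 I} (success-≽ α 𝒜 I (𝒜-stops-at-best I))))
  where
  p : ℝ
  p = signalProbability α (best I) (final (best I))

module _ (α : ℝ) {m : ℕ} (π : Policy (suc m)) where

  won-ramp : (∀ i → Wins π i) → successProbability α π (ramp (Fin.fromℕ m)) ≤ optimum α m
  won-ramp wins = ≤-trans {success} {p} {optimum α m}
    -- Any signal before the top triggers a stop at once, so only a signal at the top can still win.
    (≼⇒≤ {success} {p} (success-≼ α π (ramp top) λ s s<top → stops-once π s<top (stops-at-signal π wins s)))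
    (≤-trans {p} {coincidence α (toℕ top)} {optimum α m}
      (≼⇒≤ {p} {coincidence α (toℕ top)} λ N → ℚₚ.≤-reflexive (signalProbability-final α top N))
      (subst (λ k → coincidence α k ≤ optimum α m) (sym (Finₚ.toℕ-fromℕ m)) (coincidence≤optimum α m)))
    where
    top : Fin (suc m)
    top = Fin.fromℕ m
    success p : ℝ
    success = successProbability α π (ramp top)
    p = signalProbability α top (final top)

  unwon-ramp : ∀ i → ¬ Wins π i → successProbability α π (ramp i) ≤ optimum α m
  unwon-ramp i ¬win = ≤-trans {success} {0ℝ} {optimum α m}
    (≼⇒≤ {success} {0ℝ} (success-≼0 α π (ramp i) λ s stops → ¬win (s , stops)))
    (≼⇒≤ {0ℝ} {optimum α m} (0≤optimum α m))
    where
    success : ℝ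
    success = successProbability α π (ramp i)

  -- There are finitely many signals and ramps, so the case distinction is decidable and a ramp that
  -- is never won can be found by search.
  hard-ramp : Dec (∀ i → Wins π i) → ∃ λ i → successProbability α π (ramp i) ≤ optimum α m
  hard-ramp (yes wins) = Fin.fromℕ m , won-ramp wins
  hard-ramp (no ¬wins) = Product.map₂ (unwon-ramp _) (Finₚ.¬∀⟶∃¬ (suc m) (Wins π) (wins? π) ¬wins)

  -- One hard instance per policy suffices, so the infimum of an arbitrary policy is never computed.
  no-better-guarantee : ∀ c → (∀ I → c ≤ successProbability α π I) → c ≤ optimum α m
  no-better-guarantee c guarantee =
    let i , hard = hard-ramp (Finₚ.all? (wins? π))
    in ≤-trans {c} {successProbability α π (ramp i)} {optimum α m} (guarantee (ramp i)) hard

theorem6 : (α : ℝ) → 0ℝ < α → (n : ℕ) .{{_ : ℕ.NonZero n}} →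
    IsOptimal α (𝒜 {n}) ×
    IsWorstCase α (𝒜 {n}) (1ℝ - (1ℚ ℚ.- + 1 ℚ./ n) ^ α) ×
    IsOPT α n (1ℝ - (1ℚ ℚ.- + 1 ℚ./ n) ^ α)
theorem6 α _ (suc m) = (optimum α m , opt , worst) , worst , opt
  where
  worst : IsWorstCase α 𝒜 (optimum α m)
  -- The greatest-lower-bound half is the bound for all policies, specialised to `𝒜`.
  worst = 𝒜-guarantee α , no-better-guarantee α 𝒜
  opt : IsOPT α (suc m) (optimum α m)
  opt = (λ { w (π , below , _) → no-better-guarantee α π w below }) ,
        -- The supremum is attained by `𝒜`, so every upper bound is at least this value.
        (λ c bound → bound (optimum α m) (𝒜 , worst))
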